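{- Let $\kappa\leq\lambda$ be infinite cardinals with $\kappa$ regular, and assume $\lambda^{<\kappa}=\lambda<\mathfrak{c}=2^{\aleph_0}$. Then there is a continuous $\omega_1$-Dirac weak $\lambda^+$-measure space $({}^{\kappa}\lambda,\mathfrak{M},\mu)$ on ${}^{\kappa}\lambda$ (with $\mu$ taking values in some positively totally ordered monoid $\mathbb{S}$ with an infinitary sum $\mathsf{Sum}$).
   Context: **Topology.** ${}^{\kappa}\lambda$ is the set of sequences of elements of $\lambda$ of length $\kappa$, with the bounded topology, generated by the cones $\mathbf{N}_s=\{x\in{}^{\kappa}\lambda\mid s\subseteq x\}$ for $s\in{}^{<\kappa}\lambda=\bigcup_{\alpha<\kappa}{}^{\alpha}\lambda$. **Monoids and sums.** A positively totally ordered monoid is $\mathbb{S}=(S,0,+,\leq)$ where $+$ is associative (not necessarily commutative) with neutral element $0$, $\leq$ is a total order, $a\leq b$ and $c\leq d$ imply $a+c\leq b+d$, $0$ is the minimum of $\leq$, and $S\neq\{0\}$. ${}^{<\mathrm{On}}\mathbb{S}$ is the class of all sequences of elements of $S$ of ordinal length; $\mathrm{lh}(s)$ is the length of $s$. An infinitary sum on $\mathbb{S}$ is a partial function $\mathsf{Sum}:{}^{<\mathrm{On}}\mathbb{S}\to\mathbb{S}$ such that: (S1) $\mathsf{Sum}(\emptyset)=0$ and $\mathsf{Sum}(s)=s_0+\dots+s_n$ for every non-empty finite $s=(s_i)_{i\leq n}\in\mathrm{dom}(\mathsf{Sum})$; (S2) (continuity) for all $s\in\mathrm{dom}(\mathsf{Sum})$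 of limit length, if $s\restriction\alpha\in\mathrm{dom}(\mathsf{Sum})$ for cofinally many $\alpha<\mathrm{lh}(s)$, then $\mathsf{Sum}(s)=\sup\{\mathsf{Sum}(s\restriction\alpha)\mid\alpha<\mathrm{lh}(s),\ s\restriction\alpha\in\mathrm{dom}(\mathsf{Sum})\}$. **Measures.** A weakly $\lambda^+$-measurable space is a pair $(X,\mathfrak{M})$ where $X$ is a topological space and $\mathfrak{M}$ is a family of subsets of $X$ closed under unions of size $\leq\lambda$ and containing all open subsets of $X$. A $\lambda^+$-measure on it (with values in $(\mathbb{S},\mathsf{Sum})$) is a partial function $\mu:\mathscr{P}(X)\to\mathbb{S}$ with $\mathfrak{M}\subseteq\mathrm{dom}(\mu)$ such that: (M1) $\mu(\emptyset)=0$; (M2) $\mu(X)>0$; (M3) $A\subseteq B$ implies $\mu(A)\leq\mu(B)$ for all $A,B\in\mathfrak{M}$; (M4) for every family $(A_i)_{i<\gamma}$ of pairwise disjoint sets of $\mathfrak{M}$ of length an ordinal $\gamma<\lambda^+$, we have $\langle\mu(A_i)\mid i<\gamma\rangle\in\mathrm{dom}(\mathsf{Sum})$ and $\mu(\bigcup_{i<\gamma}A_i)=\mathsf{Sum}(\langle\mu(A_i)\mid i<\gamma\rangle)$; (M5) for every $x\in X$ with $\{x\}\in\mathfrak{M}$ and every open local basis $\{A_i\mid i<\gamma\}$ at $x$ with $\gamma<\lambda^+$, $\mu(\{x\})=\inf_{i<\gamma}\mu(A_i)$. Then $(X,\mathfrak{M},\mu)$ is called a weak $\lambda^+$-measure space.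 It is continuous if $\{x\}\in\mathfrak{M}$ and $\mu(\{x\})=0$ for every $x\in X$. The support of $\mu$ is $\mathrm{supp}(\mu)=X\setminus\bigcup\{O\mid O\text{ open},\ \mu(O)=0\}$. For a cardinal $\gamma$, $\mu$ is $\gamma$-Dirac if $\mathrm{supp}(\mu)$ has weight strictly less than $\gamma$. -}

module Defs where

open import Level using (0ℓ; _⊔_) renaming (suc to lsuc)
open import Algebra.Bundles using (Monoid)
open import Algebra.Structures using (IsMonoid)
import Algebra.Definitions.RawMonoid as RawMonoidDefs
open import Data.Fin.Base using (Fin)
import Data.Fin.Base as Fin
import Data.Fin.Induction as Fin
import Data.Fin.Properties as Fin
open import Data.Nat.Base using (ℕ)
import Data.Nat.Base as ℕ
import Data.Nat.Induction as ℕ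
import Data.Nat.Properties as ℕ
open import Data.Product.Base using (Σ; ∃; _×_; _,_; proj₁; proj₂)
open import Data.Sum.Base using (_⊎_)
open import Data.Vec.Functional using (Vector)
open import Function.Base using (_∘_)
open import Function.Bundles using (_↣_; _⤖_; _↔_; Inverse)
open import Function.Properties.Inverse using (↔-refl; ↔-sym; ↔-trans)
open import Induction.WellFounded using (WellFounded)
open import Relation.Binary.Bundles using (Setoid)
open import Relation.Binary.Core using (Rel)
open import Relation.Binary.Definitions
  using (Irrelevant; Trichotomous; tri<; tri≈; tri>)
open import Relation.Binary.Structures using (IsStrictTotalOrder; IsTotalOrder)
import Relation.Binary.Construct.NonStrictToStrict as NonStrictToStrict
import Relation.Binary.Construct.On as On
open import Relation.Binary.PropositionalEquality
  using (_≡_; _≢_; refl; sym; cong; isEquivalence)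
open import Relation.Nullary using (¬_)
open import Relation.Unary
  using (Pred; _∈_; _⊆_; _≐_; _∩_; _⊥_; ∅; U; ⋃; ∁; ｛_｝)
open import Relation.Unary.Relation.Binary.Equality using (≐-setoid)

-- Sets are types in Set₀.  The development is meant to be read under
-- excluded middle and function extensionality; the latter makes _≡_ on
-- ^κλ the equality of sequences.

𝒫 : Set → Set₁
𝒫 X = Pred X 0ℓ

infix 4 _≼_ _≺_

_≼_ : Set → Set → Set
A ≼ B = A ↣ B

_≺_ : Set → Set → Set
A ≺ B = A ≼ B × ¬ (B ≼ A)

-- Irrelevance of _<_ makes the elements of an initial segment determined
-- by their underlying elements.
record Ordinal : Set₁ where
  infix 4 _<_
  field
    Carrier            : Set
    _<_                : Rel Carrier 0ℓ
    <-irrelevant       : Irrelevant _<_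
    isStrictTotalOrder : IsStrictTotalOrder _≡_ _<_
    wellFounded        : WellFounded _<_

open Ordinal using () renaming (Carrier to ⟨_⟩)

Lt : (α : Ordinal) → Rel ⟨ α ⟩ 0ℓ
Lt = Ordinal._<_

Le : (α : Ordinal) → Rel ⟨ α ⟩ 0ℓ
Le α a b = Lt α a b ⊎ a ≡ b

-- The initial segment below a.  The ordinals smaller than α are, up to
-- isomorphism, exactly the α ↓ a.
infix 8 _↓_

_↓_ : (α : Ordinal) → ⟨ α ⟩ → Ordinal
α ↓ a = record
  { Carrier            = Σ ⟨ α ⟩ (λ b → b < a)
  ; _<_                = λ x y → proj₁ x < proj₁ y
  ; <-irrelevant       = <-irrelevant
  ; isStrictTotalOrder = record
    { isStrictPartialOrder = record
      { isEquivalence = isEquivalence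
      ; irrefl        = λ { refl → S.irrefl refl }
      ; trans         = S.trans
      ; <-resp-≈      = (λ { refl p → p }) , (λ { refl p → p })
      }
    ; compare = compare
    }
  ; wellFounded = On.wellFounded proj₁ wellFounded
  }
  where
  open Ordinal α
  module S = IsStrictTotalOrder isStrictTotalOrder

  compare : Trichotomous _≡_ (λ (x y : Σ Carrier (λ b → b < a)) → proj₁ x < proj₁ y)
  compare (x , p) (y , q) with S.compare x y
  ... | tri< l n g = tri< l (n ∘ cong proj₁) g
  ... | tri≈ l refl g = tri≈ l (cong (x ,_) (<-irrelevant p q)) g
  ... | tri> l n g = tri> l (n ∘ cong proj₁) g

ω : Ordinal
ω = record
  { Carrier            = ℕ
  ; _<_                = ℕ._<_
  ; <-irrelevant       = ℕ.<-irrelevant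
  ; isStrictTotalOrder = ℕ.<-isStrictTotalOrder
  ; wellFounded        = ℕ.<-wellFounded
  }

fin : ℕ → Ordinal
fin n = record
  { Carrier            = Fin n
  ; _<_                = Fin._<_
  ; <-irrelevant       = Fin.<-irrelevant
  ; isStrictTotalOrder = Fin.<-isStrictTotalOrder
  ; wellFounded        = Fin.<-wellFounded
  }

record _≅_ (α β : Ordinal) : Set where
  field
    bijection : ⟨ α ⟩ ↔ ⟨ β ⟩
  open Inverse bijection public using (to; from)
  field
    to-mono   : ∀ {a b} → Lt α a b → Lt β (to a) (to b)
    from-mono : ∀ {a b} → Lt β a b → Lt α (from a) (from b)

record IsLimit (α : Ordinal) : Set where
  field
    nonzero   : ⟨ α ⟩
    unbounded : (a : ⟨ α ⟩) → ∃ λ b → Lt α a b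

-- κ is an initial ordinal.
IsCardinal : Ordinal → Set
IsCardinal κ = (a : ⟨ κ ⟩) → ¬ (⟨ κ ↓ a ⟩ ⤖ ⟨ κ ⟩)

record IsInfiniteCardinal (κ : Ordinal) : Set where
  field
    isCardinal : IsCardinal κ
    infinite   : ℕ ≼ ⟨ κ ⟩

-- Every function from a smaller ordinal into κ is bounded: cof κ = κ.
IsRegular : Ordinal → Set
IsRegular κ = (a : ⟨ κ ⟩) (f : ⟨ κ ↓ a ⟩ → ⟨ κ ⟩) → ∃ λ b → ∀ i → Lt κ (f i) b

-- The successor cardinal of an infinite cardinal, as the class of
-- ordinals below it: α < Λ⁺ iff |α| ≤ Λ.
infix 9 _⁺

_⁺ : Ordinal → Pred Ordinal 0ℓ
Λ ⁺ = λ α → ⟨ α ⟩ ≼ ⟨ Λ ⟩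

ω₁ : Pred Ordinal 0ℓ
ω₁ = ω ⁺

-- An ordinal below κ is given by some a in κ, as the segment κ ↓ a.
_^_ : Ordinal → Ordinal → Set
Λ ^ κ = ⟨ κ ⟩ → ⟨ Λ ⟩

_^<_ : Ordinal → Ordinal → Set
Λ ^< κ = Σ ⟨ κ ⟩ λ a → ⟨ κ ↓ a ⟩ → ⟨ Λ ⟩

𝐍 : {κ Λ : Ordinal} → Λ ^< κ → 𝒫 (Λ ^ κ)
𝐍 (a , s) x = ∀ i → s i ≡ x (proj₁ i)

record Topology (X : Set) : Set₂ where
  field
    Open   : Pred (𝒫 X) (lsuc 0ℓ)
    resp   : ∀ {A B} → A ≐ B → Open A → Open B
    ∅-open : Open ∅
    U-open : Open U
    ∩-open : ∀ {A B} → Open A → Open B → Open (A ∩ B)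
    ⋃-open : ∀ {I : Set} {A : I → 𝒫 X} → (∀ i → Open (A i)) → Open (⋃ I A)

module _ {X I : Set} (B : I → 𝒫 X) where

  data GeneratedOpen : 𝒫 X → Set₁ where
    basic    : ∀ i → GeneratedOpen (B i)
    gen-resp : ∀ {P Q} → P ≐ Q → GeneratedOpen P → GeneratedOpen Q
    empty    : GeneratedOpen ∅
    full     : GeneratedOpen U
    inter    : ∀ {P Q} → GeneratedOpen P → GeneratedOpen Q → GeneratedOpen (P ∩ Q)
    union    : ∀ {J : Set} {P : J → 𝒫 X} →
               (∀ j → GeneratedOpen (P j)) → GeneratedOpen (⋃ J P)

  generated : Topology X
  generated = record
    { Open   = GeneratedOpen
    ; resp   = gen-resp
    ; ∅-open = empty
    ; U-open = full
    ; ∩-open = inter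
    ; ⋃-open = union
    }

boundedTopology : (κ Λ : Ordinal) → Topology (Λ ^ κ)
boundedTopology κ Λ = generated (𝐍 {κ} {Λ})

module _ {X : Set} (𝒯 : Topology X) where
  open Topology 𝒯

  record IsOpenLocalBasis {I : Set} (x : X) (A : I → 𝒫 X) : Set₁ where
    field
      isOpen  : ∀ i → Open (A i)
      centred : ∀ i → x ∈ A i
      refines : ∀ {O} → Open O → x ∈ O → ∃ λ i → A i ⊆ O

  -- The traces B i ∩ Y form a base of the subspace Y.
  record IsBaseOf {ℓ} (Y : Pred X ℓ) {I : Set} (B : I → 𝒫 X) : Set (lsuc 0ℓ ⊔ ℓ) where
    field
      isOpen  : ∀ i → Open (B i)
      refines : ∀ {O} → Open O → ∀ {y} → y ∈ Y → y ∈ O →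
                ∃ λ i → y ∈ B i × (B i ∩ Y) ⊆ O

  -- w is the least cardinality of a base of the subspace Y.
  record IsWeight {ℓ} (Y : Pred X ℓ) (w : Ordinal) : Set (lsuc 0ℓ ⊔ ℓ) where
    field
      isCardinal : IsCardinal w
      attained   : ∃ λ (B : ⟨ w ⟩ → 𝒫 X) → IsBaseOf Y B
      least      : ∀ {I : Set} {B : I → 𝒫 X} → IsBaseOf Y B → ⟨ w ⟩ ≼ I

record _⇀_ {a b ℓ₁ ℓ₂} (A : Setoid a ℓ₁) (B : Setoid b ℓ₂)
         : Set (a ⊔ b ⊔ ℓ₁ ⊔ ℓ₂ ⊔ lsuc (lsuc 0ℓ)) where
  private
    module A = Setoid A
    module B = Setoid B
  field
    dom        : Pred A.Carrier (lsuc 0ℓ)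
    dom-resp   : ∀ {x y} → x A.≈ y → dom x → dom y
    value      : ∀ {x} → x ∈ dom → B.Carrier
    value-cong : ∀ {x y} → x A.≈ y → (p : x ∈ dom) (q : y ∈ dom) → value p B.≈ value q

record PositivelyTotallyOrderedMonoid : Set₁ where
  infixl 6 _+_
  infix 4 _≈_ _≤_
  field
    Carrier      : Set
    _≈_          : Rel Carrier 0ℓ
    _≤_          : Rel Carrier 0ℓ
    _+_          : Carrier → Carrier → Carrier
    0#           : Carrier
    isMonoid     : IsMonoid _≈_ _+_ 0#
    isTotalOrder : IsTotalOrder _≈_ _≤_
    +-mono       : ∀ {a b c d} → a ≤ b → c ≤ d → a + c ≤ b + d
    0-minimum    : ∀ a → 0# ≤ a
    nontrivial   : ∃ λ a → ¬ (a ≈ 0#)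

  monoid : Monoid 0ℓ 0ℓ
  monoid = record { isMonoid = isMonoid }

  open Monoid monoid public using (setoid; rawMonoid)
  open RawMonoidDefs rawMonoid public using (sum)
  open NonStrictToStrict _≈_ _≤_ public using (_<_)

  module _ {i} {I : Set i} where

    record IsSup (f : I → Carrier) (s : Carrier) : Set i where
      field
        upper : ∀ i → f i ≤ s
        least : ∀ t → (∀ i → f i ≤ t) → s ≤ t

    record IsInf (f : I → Carrier) (s : Carrier) : Set i where
      field
        lower    : ∀ i → s ≤ f i
        greatest : ∀ t → (∀ i → t ≤ f i) → t ≤ s

module _ (𝕊 : PositivelyTotallyOrderedMonoid) where
  private module 𝕊 = PositivelyTotallyOrderedMonoid 𝕊

  record Sequence : Set₁ where
    constructor ⟪_⟫
    field
      {lh} : Ordinal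
      at   : ⟨ lh ⟩ → 𝕊.Carrier

  open Sequence

  -- Lengths are well-orders rather than von Neumann ordinals, so sequences
  -- are identified along isomorphisms of their lengths.
  record _≋_ (s t : Sequence) : Set where
    field
      lh-≅ : lh s ≅ lh t
      at-≈ : ∀ i → at s i 𝕊.≈ at t (_≅_.to lh-≅ i)

  sequenceSetoid : Setoid (lsuc 0ℓ) 0ℓ
  sequenceSetoid = record
    { Carrier       = Sequence
    ; _≈_           = _≋_
    ; isEquivalence = record { refl = ≋-refl ; sym = ≋-sym ; trans = ≋-trans }
    }
    where
    module E = Setoid 𝕊.setoid
    open _≋_

    ≋-refl : ∀ {s} → s ≋ s
    ≋-refl = record
      { lh-≅ = record
        { bijection = ↔-refl ; to-mono = λ p → p ; from-mono = λ p → p }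
      ; at-≈ = λ _ → E.refl
      }

    ≋-sym : ∀ {s t} → s ≋ t → t ≋ s
    ≋-sym {s} {t} e = record
      { lh-≅ = record
        { bijection = ↔-sym f.bijection
        ; to-mono   = f.from-mono
        ; from-mono = f.to-mono
        }
      ; at-≈ = λ i → E.trans
          (E.reflexive (cong (at t) (sym (Inverse.strictlyInverseˡ f.bijection i))))
          (E.sym (at-≈ e (f.from i)))
      }
      where module f = _≅_ (lh-≅ e)

    ≋-trans : ∀ {s t u} → s ≋ t → t ≋ u → s ≋ u
    ≋-trans d e = record
      { lh-≅ = record
        { bijection = ↔-trans f.bijection g.bijection
        ; to-mono   = g.to-mono ∘ f.to-mono
        ; from-mono = f.from-mono ∘ g.from-mono
        }
      ; at-≈ = λ i → E.trans (at-≈ d i) (at-≈ e (f.to i))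
      }
      where
      module f = _≅_ (lh-≅ d)
      module g = _≅_ (lh-≅ e)

  infix 8 _↾_

  _↾_ : (s : Sequence) → ⟨ lh s ⟩ → Sequence
  s ↾ a = ⟪_⟫ {lh s ↓ a} (λ i → at s (proj₁ i))

  record InfinitarySum : Set₂ where
    field
      partialFunction : sequenceSetoid ⇀ 𝕊.setoid
    open _⇀_ partialFunction public

    field
      sum-∅   : ∃ λ (p : ⟪_⟫ {fin 0} (λ ()) ∈ dom) → value p 𝕊.≈ 𝕊.0#
      sum-fin : ∀ n (s : Vector 𝕊.Carrier (ℕ.suc n)) (p : ⟪_⟫ {fin (ℕ.suc n)} s ∈ dom) →
                value p 𝕊.≈ 𝕊.sum s
      continuous :
        ∀ s (p : s ∈ dom) → IsLimit (lh s) →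
        (∀ a → ∃ λ b → Le (lh s) a b × s ↾ b ∈ dom) →
        𝕊.IsSup {I = Σ ⟨ lh s ⟩ λ a → s ↾ a ∈ dom} (λ (_ , q) → value q) (value p)

-- Λ is the cardinal whose successor appears in "weakly Λ⁺-measurable":
-- unions of size < Λ⁺ are those of size ≤ Λ.
record WeaklyMeasurable (Λ : Ordinal) {X : Set} (𝒯 : Topology X) : Set₂ where
  open Topology 𝒯 using (Open)
  field
    𝔐        : Pred (𝒫 X) (lsuc 0ℓ)
    𝔐-resp   : ∀ {A B} → A ≐ B → A ∈ 𝔐 → B ∈ 𝔐
    ⋃-closed : ∀ {I : Set} {A : I → 𝒫 X} → I ≼ ⟨ Λ ⟩ → (∀ i → A i ∈ 𝔐) → ⋃ I A ∈ 𝔐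
    open⊆𝔐   : ∀ {A} → Open A → A ∈ 𝔐

record Measure {Λ : Ordinal} {X : Set} {𝒯 : Topology X}
               (ℳ : WeaklyMeasurable Λ 𝒯)
               {𝕊 : PositivelyTotallyOrderedMonoid} (Sum : InfinitarySum 𝕊) : Set₂ where
  open Topology 𝒯
  open WeaklyMeasurable ℳ using (𝔐; ⋃-closed; open⊆𝔐)
  open PositivelyTotallyOrderedMonoid 𝕊
  private module Sum = InfinitarySum Sum
  field
    partialFunction : ≐-setoid X 0ℓ ⇀ setoid
    𝔐⊆dom           : 𝔐 ⊆ _⇀_.dom partialFunction

  μ : ∀ {A} → A ∈ 𝔐 → Carrier
  μ m = _⇀_.value partialFunction (𝔐⊆dom m)

  field
    μ-∅    : μ (open⊆𝔐 ∅-open) ≈ 0#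
    μ-U    : 0# < μ (open⊆𝔐 U-open)
    μ-mono : ∀ {A B} (a : A ∈ 𝔐) (b : B ∈ 𝔐) → A ⊆ B → μ a ≤ μ b
    μ-⋃    : ∀ (γ : Ordinal) (γ<Λ⁺ : γ ∈ Λ ⁺) (A : ⟨ γ ⟩ → 𝒫 X) (m : ∀ i → A i ∈ 𝔐) →
             (∀ i j → i ≢ j → A i ⊥ A j) →
             ∃ λ (p : ⟪_⟫ {lh = γ} (λ i → μ (m i)) ∈ Sum.dom) →
               μ (⋃-closed γ<Λ⁺ m) ≈ Sum.value p
    μ-inf  : ∀ x (m : ｛ x ｝ ∈ 𝔐) (γ : Ordinal) → γ ∈ Λ ⁺ →
             (A : ⟨ γ ⟩ → 𝒫 X) (basis : IsOpenLocalBasis 𝒯 x A) →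
             IsInf (λ i → μ (open⊆𝔐 (IsOpenLocalBasis.isOpen basis i))) (μ m)

  IsContinuous : Set₁
  IsContinuous = ∀ x → ∃ λ (m : ｛ x ｝ ∈ 𝔐) → μ m ≈ 0#

  supp : Pred X (lsuc 0ℓ)
  supp = ∁ (λ x → ∃ λ O → x ∈ O × ∃ λ (o : Open O) → μ (open⊆𝔐 o) ≈ 0#)

  -- γ-Dirac, for a cardinal γ given as the class of ordinals below it.
  IsDirac : Pred Ordinal 0ℓ → Set₁
  IsDirac γ = ∃ λ w → IsWeight 𝒯 supp w × w ∈ γ

{-# OPTIONS --safe #-}
module Submission where

-- Since Λ^<κ = Λ < 2^ℵ₀, the cardinal κ is ω, and the Cantor space embeds in
-- ^κΛ through two points of Λ.  The measure is Lebesgue measure of the trace on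
-- the Cantor space, on the family 𝔐 of sets which are open up to at most Λ many
-- points.  To make it depend only on the set, a cone counts as contained in A
-- when at most Λ many of its points are missing from A.
--
-- Disjoint sums are defined as suprema of finite subsums, so that the content of
-- (M4) is an approximation from inside: if open sets U i cover the Cantor space
-- up to Λ many points, then cones contained in some U i have total measure
-- arbitrarily close to 1.  Otherwise consider the cones in which the U i do not
-- have full measure.  Some such cone splits into two of the same kind, below
-- each of them again, and so on: this is a perfect tree, whose 2^ℵ₀ branches
-- all avoid the U i.

open import Defs
open import Level using (Lift; lift)
open import Algebra.Definitions using (Commutative)
open import Algebra.Structures using (IsMonoid)
open import Axiom.ExcludedMiddle using (ExcludedMiddle)
open import Axiom.Extensionality.Propositional using (Extensionality)
open import Data.Bool.Base using (Bool; true; false; if_then_else_)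
import Data.Bool.Base as Bool
open import Data.Empty using (⊥)
open import Data.Fin.Base using (Fin; fromℕ<)
import Data.Fin.Properties as Fin
open import Data.List.Base
  using (List; []; _∷_; _++_; map; foldr; tabulate; allFin; deduplicate)
open import Data.List.Membership.Propositional using (_∈_)
open import Data.List.Membership.Propositional.Properties
  using (∈-∃++; ∈-++⁻; ∈-++⁺ˡ; ∈-++⁺ʳ; ∈-allFin; ∈-deduplicate⁺)
open import Data.List.Relation.Binary.Subset.Propositional using (_⊆_)
open import Data.List.Relation.Unary.All using (All; []; _∷_)
import Data.List.Relation.Unary.All as All
open import Data.List.Relation.Unary.Any using (here; there)
open import Data.List.Relation.Unary.Unique.DecPropositional.Properties using (deduplicate-!)
open import Data.List.Relation.Unary.Unique.Propositional using (Unique; []; _∷_)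
import Data.List.Relation.Unary.Unique.Propositional.Properties as Unique
open import Data.Nat.Base
  using (ℕ; zero; suc; _+_; _*_; _≤_; _<_; s≤s; z≤n; _≡ᵇ_; >-nonZero) renaming (_^_ to _**_)
open import Data.Nat.Binary.Base using (ℕᵇ; 2[1+_]; 1+[2_]; toℕ; fromℕ)
import Data.Nat.Binary.Base as ℕᵇ
open import Data.Nat.Binary.Properties using (fromℕ-toℕ)
open import Data.Nat.ListAction using (sum)
open import Data.Nat.Properties
open import Algebra.Properties.CommutativeSemigroup +-commutativeSemigroup using (interchange)
open import Data.Nat.Tactic.RingSolver using (solve-∀)
open import Data.Product.Base using (Σ; ∃; _×_; _,_; proj₁; proj₂)
open import Data.Product.Properties.WithK using (,-injectiveʳ)
open import Data.Sum.Base using (_⊎_; inj₁; inj₂)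
open import Data.Unit.Base using (⊤; tt)
open import Function.Base using (_∘_; id)
open import Function.Bundles using (_⤖_; Bijection; Injection; Inverse; mk↣)
open import Function.Definitions using (Injective)
open import Induction.WellFounded using (Acc; acc)
open import Relation.Binary.Bundles using (Setoid)
open import Relation.Binary.Definitions using (DecidableEquality; tri<; tri≈; tri>)
open import Relation.Binary.PropositionalEquality
  using (_≡_; _≢_; refl; sym; trans; cong; cong₂; cong-app; subst; module ≡-Reasoning)
open import Relation.Binary.Structures
  using (IsEquivalence; IsStrictTotalOrder; IsTotalOrder)
open import Relation.Nullary using (¬_; Dec; yes; no)
open import Relation.Nullary.Negation using (contradiction)

-- Extended non-negative reals as suprema of dyadic rationals.

infixl 8 2^_

2^_ : ℕ → ℕ
2^ n = 2 ** n

2^-+ : ∀ m n → 2^ (m + n) ≡ 2^ m * 2^ n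
2^-+ = ^-distribˡ-+-* 2

1≤2^ : ∀ n → 1 ≤ 2^ n
1≤2^ = m^n>0 2

n≤2^n : ∀ n → n ≤ 2^ n
n≤2^n zero    = z≤n
n≤2^n (suc n) = ≤-trans (+-mono-≤ (1≤2^ n) (n≤2^n n)) (≤-reflexive (cong (2^ n +_) (sym (+-identityʳ _))))

                                                                             
              
-- `at n / 2ⁿ` is a non-decreasing sequence, by `doubling`; the record stands for its supremum in
-- [0, ∞].
record Dyadic : Set where
  field
    at       : ℕ → ℕ
    doubling : ∀ n → 2 * at n ≤ at (suc n)

open Dyadic

infix 4 _≲_

                                                                            
                 
-- Divided by `2ᵐ⁺ⁿ`, the bound says that the `n`-th term of `x` exceeds some later term of `y` by
-- at most `2⁻ⁿ`. As this slack tends to 0, the relation compares suprema, even where one is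
-- attained and the other only approached.
record _≲_ (x y : Dyadic) : Set where
  constructor limit-≤
  field
    bound : ∀ n → ∃ λ m → 2^ m * at x n ≤ at y (m + n) + 2^ m

open _≲_

at-+ : ∀ x m n → 2^ m * at x n ≤ at x (m + n)
at-+ x zero    n = ≤-reflexive (*-identityˡ _)
at-+ x (suc m) n = begin
  2 * 2^ m * at x n   ≡⟨ *-assoc 2 (2^ m) (at x n) ⟩
  2 * (2^ m * at x n) ≤⟨ *-monoʳ-≤ 2 (at-+ x m n) ⟩
  2 * at x (m + n)    ≤⟨ doubling x (m + n) ⟩
  at x (suc m + n)    ∎
  where open ≤-Reasoning

-- The scaled terms of `y` do not decrease, so a witness `m` may be enlarged. This brings two
-- witnesses to a common value.
raise : ∀ y {a n m} k → 2^ m * a ≤ at y (m + n) + 2^ m →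
        2^ (k + m) * a ≤ at y ((k + m) + n) + 2^ (k + m)
raise y {a} {n} {m} k p = begin
  2^ (k + m) * a                          ≡⟨ cong (_* a) (2^-+ k m) ⟩
  2^ k * 2^ m * a                         ≡⟨ *-assoc (2^ k) (2^ m) a ⟩
  2^ k * (2^ m * a)                       ≤⟨ *-monoʳ-≤ (2^ k) p ⟩
  2^ k * (at y (m + n) + 2^ m)            ≡⟨ *-distribˡ-+ (2^ k) (at y (m + n)) (2^ m) ⟩
  2^ k * at y (m + n) + 2^ k * 2^ m       ≤⟨ +-mono-≤ (at-+ y k (m + n)) (≤-reflexive (sym (2^-+ k m))) ⟩
  at y (k + (m + n)) + 2^ (k + m)         ≡⟨ cong (λ i → at y i + 2^ (k + m)) (sym (+-assoc k m n)) ⟩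
  at y ((k + m) + n) + 2^ (k + m)         ∎
  where open ≤-Reasoning

pointwise⇒≲ : ∀ {x y} → (∀ n → at x n ≤ at y n) → x ≲ y
pointwise⇒≲ {x} {y} p = limit-≤ λ n → 0 , (begin
  1 * at x n   ≡⟨ *-identityˡ _ ⟩
  at x n       ≤⟨ p n ⟩
  at y n       ≤⟨ m≤m+n _ 1 ⟩
  at y n + 1   ∎)
  where open ≤-Reasoning

≲-refl : ∀ {x} → x ≲ x
≲-refl = pointwise⇒≲ λ _ → ≤-refl

≲-trans : ∀ {x y z} → x ≲ y → y ≲ z → x ≲ z
-- Starting one index later halves the slack: the errors `2⁻ⁿ⁻¹` and `2⁻ᵐ⁻ⁿ⁻¹` add up to at most
-- `2⁻ⁿ`.
bound (≲-trans {x} {y} {z} p q) n with bound p (suc n)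
... | m , p′ with bound q (m + suc n)
... | k , q′ = k + (m + 1) , (begin
  2^ (k + (m + 1)) * at x n                   ≡⟨ cong (_* at x n) split ⟩
  2^ k * (2^ m * 2) * at x n                  ≡⟨ arrange (2^ k) (2^ m) (at x n) ⟩
  2^ k * (2^ m * (2 * at x n))                ≤⟨ *-monoʳ-≤ (2^ k) (*-monoʳ-≤ (2^ m) (doubling x n)) ⟩
  2^ k * (2^ m * at x (suc n))                ≤⟨ *-monoʳ-≤ (2^ k) p′ ⟩
  2^ k * (at y (m + suc n) + 2^ m)            ≡⟨ *-distribˡ-+ (2^ k) (at y (m + suc n)) (2^ m) ⟩
  2^ k * at y (m + suc n) + 2^ k * 2^ m       ≤⟨ +-monoˡ-≤ _ q′ ⟩
  at z (k + (m + suc n)) + 2^ k + 2^ k * 2^ m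
    ≤⟨ +-monoˡ-≤ _ (+-monoʳ-≤ (at z (k + (m + suc n))) (m≤m*n (2^ k) (2^ m) {{>-nonZero (1≤2^ m)}})) ⟩
  at z (k + (m + suc n)) + 2^ k * 2^ m + 2^ k * 2^ m
                                              ≡⟨ collect (at z (k + (m + suc n))) (2^ k) (2^ m) ⟩
  at z (k + (m + suc n)) + 2^ k * (2^ m * 2)  ≡⟨ cong₂ (λ i j → at z i + j) (index k m n) (sym split) ⟩
  at z (k + (m + 1) + n) + 2^ (k + (m + 1))   ∎)
  where
  open ≤-Reasoning

  split : 2^ (k + (m + 1)) ≡ 2^ k * (2^ m * 2)
  split = trans (2^-+ k (m + 1)) (cong (2^ k *_) (2^-+ m 1))

  arrange : ∀ a b c → a * (b * 2) * c ≡ a * (b * (2 * c))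
  arrange = solve-∀

  collect : ∀ a b c → a + b * c + b * c ≡ a + b * (c * 2)
  collect = solve-∀

  index : ∀ k m n → k + (m + suc n) ≡ k + (m + 1) + n
  index = solve-∀

0ᴰ : Dyadic
0ᴰ = record { at = λ _ → 0 ; doubling = λ _ → z≤n }

1ᴰ : Dyadic
1ᴰ = record { at = 2^_ ; doubling = λ _ → ≤-refl }

infixl 6 _⊕_

_⊕_ : Dyadic → Dyadic → Dyadic
x ⊕ y = record
  { at       = λ n → at x n + at y n
  ; doubling = λ n → ≤-trans (≤-reflexive (*-distribˡ-+ 2 (at x n) (at y n)))
                             (+-mono-≤ (doubling x n) (doubling y n))
  }

⊕-mono : ∀ {x y u v} → x ≲ y → u ≲ v → x ⊕ u ≲ y ⊕ v
-- Again index `suc n`, so that the two slacks together make `2⁻ⁿ`.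
bound (⊕-mono {x} {y} {u} {v} p q) n with bound p (suc n) | bound q (suc n)
... | k , p′ | m , q′ = suc (k + m) , (begin
  2 * 2^ (k + m) * (at x n + at u n)             ≡⟨ arrange (2^ (k + m)) (at x n) (at u n) ⟩
  2^ (k + m) * (2 * at x n) + 2^ (k + m) * (2 * at u n)
    ≤⟨ +-mono-≤ (*-monoʳ-≤ (2^ (k + m)) (doubling x n)) (*-monoʳ-≤ (2^ (k + m)) (doubling u n)) ⟩
  2^ (k + m) * at x (suc n) + 2^ (k + m) * at u (suc n)
    ≤⟨ +-mono-≤ (subst (λ i → 2^ i * at x (suc n) ≤ at y (i + suc n) + 2^ i) (+-comm m k) (raise y {m = k} m p′))
                (raise v {m = m} k q′) ⟩
  (at y (k + m + suc n) + 2^ (k + m)) + (at v (k + m + suc n) + 2^ (k + m))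
    ≡⟨ collect (at y (k + m + suc n)) (at v (k + m + suc n)) (2^ (k + m)) ⟩
  at y (k + m + suc n) + at v (k + m + suc n) + 2 * 2^ (k + m)
    ≡⟨ cong (λ i → at y i + at v i + 2 * 2^ (k + m)) (+-suc (k + m) n) ⟩
  at y (suc (k + m) + n) + at v (suc (k + m) + n) + 2^ suc (k + m) ∎)
  where
  open ≤-Reasoning

  arrange : ∀ a b c → 2 * a * (b + c) ≡ a * (2 * b) + a * (2 * c)
  arrange = solve-∀

  collect : ∀ a b c → (a + c) + (b + c) ≡ a + b + 2 * c
  collect = solve-∀

infix 4 _≃_

_≃_ : Dyadic → Dyadic → Set
x ≃ y = x ≲ y × y ≲ x

pointwise⇒≃ : ∀ {x y} → (∀ n → at x n ≡ at y n) → x ≃ y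
pointwise⇒≃ p = pointwise⇒≲ (λ n → ≤-reflexive (p n)) , pointwise⇒≲ (λ n → ≤-reflexive (sym (p n)))

⊕-comm : ∀ x y → x ⊕ y ≃ y ⊕ x
⊕-comm x y = pointwise⇒≃ λ n → +-comm (at x n) (at y n)

1ᴰ≴0ᴰ : ¬ (1ᴰ ≲ 0ᴰ)
-- At index 0 the slack is 1 and hides the difference; at index 1 it is only ½.
1ᴰ≴0ᴰ p with bound p 1
... | m , p′ = contradiction p′ (<⇒≱ (m<m*n (2^ m) 2 {{>-nonZero (1≤2^ m)}} ≤-refl))

module _ (em : ∀ {ℓ} → ExcludedMiddle ℓ) where

  -- If `x ≲ y` fails at index `n`, then the `n`-th term of `x` exceeds every term of `y` from index
  -- `n` on, so `n` is a witness for `y ≲ x` at every index.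
  ≲-total : ∀ x y → x ≲ y ⊎ y ≲ x
  ≲-total x y with em {P = ∃ λ n → ∀ m → ¬ (2^ m * at x n ≤ at y (m + n) + 2^ m)}
  ... | yes (n , h) = inj₂ (limit-≤ λ k → n , (begin
    2^ n * at y k         ≤⟨ at-+ y n k ⟩
    at y (n + k)          ≡⟨ cong (at y) (+-comm n k) ⟩
    at y (k + n)          ≤⟨ m≤m+n _ (2^ k) ⟩
    at y (k + n) + 2^ k   ≤⟨ <⇒≤ (≰⇒> (h k)) ⟩
    2^ k * at x n         ≤⟨ at-+ x k n ⟩
    at x (k + n)          ≡⟨ cong (at x) (+-comm k n) ⟩
    at x (n + k)          ≤⟨ m≤m+n _ (2^ n) ⟩
    at x (n + k) + 2^ n   ∎))
    where open ≤-Reasoning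
  ... | no h = inj₁ (limit-≤ λ n → found n em)
    where
    found : ∀ n → Dec (∃ λ m → 2^ m * at x n ≤ at y (m + n) + 2^ m) →
            ∃ λ m → 2^ m * at x n ≤ at y (m + n) + 2^ m
    found n (yes r) = r
    found n (no ¬r) = contradiction (n , λ m r → ¬r (m , r)) h

  dyadicMonoid : PositivelyTotallyOrderedMonoid
  dyadicMonoid = record
    { Carrier      = Dyadic
    ; _≈_          = _≃_
    ; _≤_          = _≲_
    ; _+_          = _⊕_
    ; 0#           = 0ᴰ
    ; isMonoid     = record
      { isSemigroup = record
        { isMagma = record
          { isEquivalence = isEquivalence
          ; ∙-cong        = λ (p , p′) (q , q′) → ⊕-mono p q , ⊕-mono p′ q′
          }
        ; assoc   = λ x y z → pointwise⇒≃ λ n → +-assoc (at x n) (at y n) (at z n)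
        }
      ; identity    = (λ x → pointwise⇒≃ λ _ → refl)
                    , (λ x → pointwise⇒≃ λ n → +-identityʳ (at x n))
      }
    ; isTotalOrder = record
      { isPartialOrder = record
        { isPreorder = record
          { isEquivalence = isEquivalence
          ; reflexive     = proj₁
          ; trans         = ≲-trans
          }
        ; antisym    = _,_
        }
      ; total          = ≲-total
      }
    ; +-mono       = ⊕-mono
    ; 0-minimum    = λ _ → pointwise⇒≲ λ _ → z≤n
    ; nontrivial   = 1ᴰ , λ p → 1ᴰ≴0ᴰ (proj₁ p)
    }
    where
    isEquivalence : IsEquivalence _≃_
    isEquivalence = record
      { refl  = ≲-refl , ≲-refl
      ; sym   = λ (p , q) → q , p
      ; trans = λ (p , p′) (q , q′) → ≲-trans p q , ≲-trans q′ p′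
      }

-- Unordered infinite sums in a commutative monoid.

module InfiniteSums (𝕊 : PositivelyTotallyOrderedMonoid)
  (comm : Commutative (PositivelyTotallyOrderedMonoid._≈_ 𝕊) (PositivelyTotallyOrderedMonoid._+_ 𝕊))
  where

  private
    module 𝕊 = PositivelyTotallyOrderedMonoid 𝕊
    open IsMonoid 𝕊.isMonoid using (assoc; ∙-congˡ; ∙-congʳ) renaming (refl to ≈-refl; sym to ≈-sym; trans to ≈-trans)
    open IsTotalOrder 𝕊.isTotalOrder using ()
      renaming (refl to ≤ˢ-refl; reflexive to ≤ˢ-reflexive; trans to ≤ˢ-trans; antisym to ≤ˢ-antisym)

  total : ∀ {I : Set} → (I → 𝕊.Carrier) → List I → 𝕊.Carrier
  total f = foldr (λ i a → f i 𝕊.+ a) 𝕊.0#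

  total-insert : ∀ {I : Set} (f : I → 𝕊.Carrier) xs {x ys} →
                 total f (xs ++ x ∷ ys) 𝕊.≈ f x 𝕊.+ total f (xs ++ ys)
  total-insert f []       = ≈-refl
  total-insert f (z ∷ zs) {x} {ys} = ≈-trans (∙-congˡ (total-insert f zs))
    (≈-trans (≈-sym (assoc _ _ _)) (≈-trans (∙-congʳ (comm _ _)) (assoc _ _ _)))

  -- By commutativity each entry of `F` can be moved to the front of `G` and split off; what remains
  -- of `G` is at least 0.
  total-⊆ : ∀ {I : Set} (f : I → 𝕊.Carrier) {F G} → Unique F → F ⊆ G → total f F 𝕊.≤ total f G
  total-⊆ f {[]}    _          _ = 𝕊.0-minimum _
  total-⊆ f {x ∷ F} (x∉F ∷ uq) F⊆G with ∈-∃++ (F⊆G (here refl))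
  ... | G₁ , G₂ , refl = ≤ˢ-trans (𝕊.+-mono ≤ˢ-refl (total-⊆ f uq F⊆))
                                  (≤ˢ-reflexive (≈-sym (total-insert f G₁)))
    where
    F⊆ : F ⊆ G₁ ++ G₂
    F⊆ i with ∈-++⁻ G₁ (F⊆G (there i))
    ... | inj₁ j         = ∈-++⁺ˡ j
    ... | inj₂ (here e)  = contradiction (sym e) (All.lookup x∉F i)
    ... | inj₂ (there j) = ∈-++⁺ʳ G₁ j

  total-map : ∀ {I J : Set} {f : I → 𝕊.Carrier} {g : J → 𝕊.Carrier} (h : J → I) →
              (∀ j → g j 𝕊.≤ f (h j)) → ∀ F → total g F 𝕊.≤ total f (map h F)
  total-map h g≤f []      = ≤ˢ-refl
  total-map h g≤f (x ∷ F) = 𝕊.+-mono (g≤f x) (total-map h g≤f F)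

  total-tabulate : ∀ {I : Set} (f : I → 𝕊.Carrier) {n} (h : Fin n → I) →
                   total f (tabulate h) ≡ 𝕊.sum (f ∘ h)
  total-tabulate f {zero}  h = refl
  total-tabulate f {suc n} h = cong (f (h Fin.zero) 𝕊.+_) (total-tabulate f (h ∘ Fin.suc))

  -- Unconditional summation: duplicate-free lists stand for the finite sets of indices.
  HasSum : ∀ {I : Set} → (I → 𝕊.Carrier) → 𝕊.Carrier → Set
  HasSum {I} f = 𝕊.IsSup {I = ∃ λ (F : List I) → Unique F} (total f ∘ proj₁)

  UpperBound : ∀ {I : Set} → (I → 𝕊.Carrier) → 𝕊.Carrier → Set
  UpperBound {I} f v = ∀ (F : ∃ λ (F : List I) → Unique F) → total f (proj₁ F) 𝕊.≤ v

  -- An injection keeps lists duplicate-free, so each finite subsum of `g` is dominated by one of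
  -- `f`. This serves both for isomorphic lengths and for initial segments.
  reindex : ∀ {I J : Set} {f : I → 𝕊.Carrier} {g : J → 𝕊.Carrier} {v} (h : J → I) →
            Injective _≡_ _≡_ h → (∀ j → g j 𝕊.≤ f (h j)) → UpperBound f v → UpperBound g v
  reindex h inj g≤f ub (F , uq) = ≤ˢ-trans (total-map h g≤f F) (ub (map h F , Unique.map⁺ inj uq))

  module _ {s t : Sequence 𝕊} (e : _≋_ 𝕊 s t) where
    open Sequence
    open _≋_ e
    open _≅_ lh-≅

    upperBound-≋ : ∀ {v} → UpperBound (at t) v → UpperBound (at s) v
    upperBound-≋ = reindex to to-injective (≤ˢ-reflexive ∘ at-≈)
      where
      to-injective : Injective _≡_ _≡_ to
      to-injective {x} {y} p = trans (sym (Inverse.strictlyInverseʳ bijection x))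
        (trans (cong from p) (Inverse.strictlyInverseʳ bijection y))

  hasSum-≤ : ∀ {s t v w} → _≋_ 𝕊 s t → HasSum (Sequence.at s) v → HasSum (Sequence.at t) w → v 𝕊.≤ w
  hasSum-≤ e p q = 𝕊.IsSup.least p _ (upperBound-≋ e (𝕊.IsSup.upper q))

  finitelyBounded : (α : Ordinal) → IsLimit α → ∀ F → ∃ λ a → All (λ i → Lt α i a) F
  finitelyBounded α lim []      = IsLimit.nonzero lim , []
  finitelyBounded α lim (x ∷ F) with finitelyBounded α lim F
  ... | a , F<a with IsStrictTotalOrder.compare (Ordinal.isStrictTotalOrder α) x a
  ...   | tri< x<a _ _ = a , x<a ∷ F<a
  ...   | tri≈ _ refl _ = let b , a<b = IsLimit.unbounded lim a in
      b , a<b ∷ All.map (λ i<a → IsStrictTotalOrder.trans (Ordinal.isStrictTotalOrder α) i<a a<b) F<a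
  ...   | tri> _ _ a<x = let b , x<b = IsLimit.unbounded lim x in
      b , x<b ∷ All.map (λ i<a → IsStrictTotalOrder.trans (Ordinal.isStrictTotalOrder α)
                                   (IsStrictTotalOrder.trans (Ordinal.isStrictTotalOrder α) i<a a<x) x<b) F<a

  restrictList : ∀ {I : Set} {P : I → Set} {F} → All P F → ∃ λ (F′ : List (Σ I P)) → map proj₁ F′ ≡ F
  restrictList []       = [] , refl
  restrictList (p ∷ ps) = let F′ , e = restrictList ps in (_ , p) ∷ F′ , cong (_ ∷_) e

  infinitarySum : InfinitarySum 𝕊
  infinitarySum = record
    { partialFunction = record
      { dom        = λ s → Lift _ (∃ (HasSum (Sequence.at s)))
      ; dom-resp   = λ e (lift (v , p)) → lift (v , record
        { upper = upperBound-≋ (≋-sym e) (𝕊.IsSup.upper p)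
        ; least = λ t ub → 𝕊.IsSup.least p t (upperBound-≋ e ub)
        })
      ; value      = λ (lift (v , _)) → v
      ; value-cong = λ e (lift (_ , p)) (lift (_ , q)) →
          ≤ˢ-antisym (hasSum-≤ e p q) (hasSum-≤ (≋-sym e) q p)
      }
    ; sum-∅      = lift (𝕊.0# , record
      { upper = λ { ([] , _) → ≤ˢ-refl ; (() ∷ _ , _) }
      ; least = λ t ub → ub ([] , [])
      }) , ≈-refl
    -- The list of all indices dominates every duplicate-free list, so the supremum is attained
    -- there.
    ; sum-fin    = λ n s (lift (v , p)) → ≤ˢ-antisym
        (𝕊.IsSup.least p _ λ (F , uq) → ≤ˢ-trans
          (total-⊆ s uq (λ {i} _ → ∈-allFin i)) (≤ˢ-reflexive (≡⇒≈ (total-tabulate s id))))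
        (≤ˢ-trans (≤ˢ-reflexive (≈-sym (≡⇒≈ (total-tabulate s id))))
                  (𝕊.IsSup.upper p (allFin (suc n) , Unique.allFin⁺ (suc n))))
    ; continuous = λ s (lift (v , p)) lim cofinal → record
      { upper = λ (a , lift (w , q)) → 𝕊.IsSup.least q v
          (reindex proj₁ (Ordinal-irrelevant (Sequence.lh s)) (λ _ → ≤ˢ-refl) (𝕊.IsSup.upper p))
      ; least = λ t ub → 𝕊.IsSup.least p t λ (F , uq) → finite≤ s lim cofinal t ub F uq
      }
    }
    where
    ≋-sym = λ {s} {t} → Setoid.sym (sequenceSetoid 𝕊) {s} {t}

    ≡⇒≈ : ∀ {a b} → a ≡ b → a 𝕊.≈ b
    ≡⇒≈ refl = ≈-refl

    Ordinal-irrelevant : ∀ (α : Ordinal) {a} →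
      Injective _≡_ _≡_ (proj₁ {A = Ordinal.Carrier α} {B = λ b → Lt α b a})
    Ordinal-irrelevant α {x = x , p} {y = .x , q} refl = cong (x ,_) (Ordinal.<-irrelevant α p q)

    Summable : Sequence 𝕊 → Set₁
    Summable s = Lift _ (∃ (HasSum (Sequence.at s)))

    -- The core of (S2): a finite set of indices is bounded in a limit length, so its subsum is
    -- already a subsum of some summable restriction.
    finite≤ : ∀ s → IsLimit (Sequence.lh s) →
      (∀ a → ∃ λ b → Le (Sequence.lh s) a b × Summable (_↾_ 𝕊 s b)) →
      ∀ t → (∀ (r : ∃ λ a → Summable (_↾_ 𝕊 s a)) → proj₁ (Lift.lower (proj₂ r)) 𝕊.≤ t) →
      ∀ F → Unique F → total (Sequence.at s) F 𝕊.≤ t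
    finite≤ s lim cofinal t ub F uq with finitelyBounded (Sequence.lh s) lim F
    ... | a , F<a with cofinal a
    ...   | b , a≤b , lift (w , q) with restrictList (All.map (λ i<a → widen a≤b i<a) F<a)
      where
      widen : ∀ {i} → Le (Sequence.lh s) a b → Lt (Sequence.lh s) i a → Lt (Sequence.lh s) i b
      widen (inj₁ a<b)  i<a = IsStrictTotalOrder.trans (Ordinal.isStrictTotalOrder (Sequence.lh s)) i<a a<b
      widen (inj₂ refl) i<a = i<a
    ...     | F′ , refl = ≤ˢ-trans (≤ˢ-reflexive (total-proj₁ F′))
                (≤ˢ-trans (𝕊.IsSup.upper q (F′ , Unique.map⁻ uq)) (ub (b , lift (w , q))))
      where
      total-proj₁ : ∀ F′ → total (Sequence.at s) (map proj₁ F′) 𝕊.≈ total (Sequence.at s ∘ proj₁) F′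
      total-proj₁ []       = ≈-refl
      total-proj₁ (x ∷ F′) = ∙-congˡ (total-proj₁ F′)

-- Counting words in the binary tree.

Cantor : Set
Cantor = ℕ → Bool

cons : Bool → Cantor → Cantor
cons b x zero    = b
cons b x (suc n) = x n

Agree : ℕ → {A : Set} → (ℕ → A) → (ℕ → A) → Set
Agree n x y = ∀ k → k < n → x k ≡ y k

agree-cons : ∀ {n} b {x y} → Agree n x y → Agree (suc n) (cons b x) (cons b y)
agree-cons b p zero    _         = refl
agree-cons b p (suc k) (s≤s k<n) = p k k<n

indicator : {P : Set} → Dec P → ℕ
indicator (yes _) = 1
indicator (no _)  = 0

indicator-mono : ∀ {P Q : Set} → (P → Q) → (p : Dec P) (q : Dec Q) → indicator p ≤ indicator q
indicator-mono f (yes p) (yes q) = ≤-refl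
indicator-mono f (yes p) (no ¬q) = contradiction (f p) ¬q
indicator-mono f (no _)  q       = z≤n

Σ[_]_ : {I : Set} → List I → (I → ℕ) → ℕ
Σ[ F ] f = sum (map f F)

Σ-+ : ∀ {I : Set} (F : List I) f g → Σ[ F ] (λ i → f i + g i) ≡ Σ[ F ] f + Σ[ F ] g
Σ-+ []      f g = refl
Σ-+ (x ∷ F) f g = trans (cong (f x + g x +_) (Σ-+ F f g)) (interchange (f x) (g x) (Σ[ F ] f) (Σ[ F ] g))

term-≤-Σ : ∀ {I : Set} (f : I → ℕ) {i F} → i ∈ F → f i ≤ Σ[ F ] f
term-≤-Σ f (here refl) = m≤m+n _ _
term-≤-Σ f (there p)   = ≤-trans (term-≤-Σ f p) (m≤n+m _ _)

module Counting (em : ∀ {ℓ} → ExcludedMiddle ℓ) {T : Set₁} (step : Bool → T → T) where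

  -- A value of `T` describes the situation in one cone, and `step b` passes to the half given by
  -- the bit `b`. Thus words of length `n` are counted whose cone satisfies `φ`. `T` is instantiated
  -- both with subsets of the Cantor space and with families of subsets.
  count : (T → Set) → ℕ → T → ℕ
  count φ zero    t = indicator (em {P = φ t})
  count φ (suc n) t = count φ n (step false t) + count φ n (step true t)

  count-complement : ∀ φ n t → count φ n t + count (¬_ ∘ φ) n t ≡ 2^ n
  count-complement φ zero t = opposite em em
    where
    opposite : (p : Dec (φ t)) (q : Dec (¬ φ t)) → indicator p + indicator q ≡ 1
    opposite (yes p) (yes q) = contradiction p q
    opposite (yes p) (no q)  = refl
    opposite (no p)  (yes q) = refl
    opposite (no p)  (no q)  = contradiction p q
  count-complement φ (suc n) t = begin
    (a + b) + (c + d) ≡⟨ interchange a b c d ⟩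
    (a + c) + (b + d) ≡⟨ cong₂ _+_ (count-complement φ n (step false t)) (count-complement φ n (step true t)) ⟩
    2^ n + 2^ n       ≡⟨ cong (2^ n +_) (sym (+-identityʳ _)) ⟩
    2^ suc n          ∎
    where
    open ≡-Reasoning
    a = count φ n (step false t)
    b = count φ n (step true t)
    c = count (¬_ ∘ φ) n (step false t)
    d = count (¬_ ∘ φ) n (step true t)

  count-≤ : ∀ φ n t → count φ n t ≤ 2^ n
  count-≤ φ n t = ≤-trans (m≤m+n _ _) (≤-reflexive (count-complement φ n t))

  -- Both one-bit extensions of a counted word are counted at the next level.
  count-doubling : ∀ φ → (∀ b t → φ t → φ (step b t)) → ∀ n t → 2 * count φ n t ≤ count φ (suc n) t
  count-doubling φ hereditary zero t = ≤-trans (≤-reflexive (cong (indicator em +_) (+-identityʳ _)))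
    (+-mono-≤ (indicator-mono (hereditary false t) em em) (indicator-mono (hereditary true t) em em))
  count-doubling φ hereditary (suc n) t = ≤-trans (≤-reflexive (*-distribˡ-+ 2 (count φ n (step false t)) _))
    (+-mono-≤ (count-doubling φ hereditary n (step false t)) (count-doubling φ hereditary n (step true t)))

-- Small sets, and the measure of subsets of the Cantor space.

module Smallness (em : ∀ {ℓ} → ExcludedMiddle ℓ) (ext : ∀ {a b} → Extensionality a b)
  (L : Set) (bits : Bool ≼ L) (pairs : (L × L) ≼ L) (L-uncountable : ¬ (Cantor ≼ L)) where

  private
    l₀ : L
    l₀ = Injection.to bits false

  -- |B| ≤ |L|.
  Small : {X : Set} → (X → Set) → Set
  Small {X} B = ∃ λ (f : X → L) → ∀ {x y} → B x → B y → f x ≡ f y → x ≡ y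

  small-⊆ : ∀ {X} {B D : X → Set} → (∀ x → B x → D x) → Small D → Small B
  small-⊆ B⊆D (f , inj) = f , λ p q → inj (B⊆D _ p) (B⊆D _ q)

  small-∘ : ∀ {X Y} {B : X → Set} {h : Y → X} → Injective _≡_ _≡_ h → Small B → Small (B ∘ h)
  small-∘ {h = h} h-inj (f , inj) = f ∘ h , λ p q e → h-inj (inj p q e)

  small-singleton : ∀ {X} {B : X → Set} → (∀ x y → B x → B y → x ≡ y) → Small B
  small-singleton single = (λ _ → l₀) , λ p q _ → single _ _ p q

  -- Excluded middle selects one index `i` for each point `x` of the union. The codes of `i` in `L`
  -- and of `x` in `B i` form a pair that determines `x`, and `pairs` brings it back into `L`.
  small-⋃ : ∀ {X I} {B : I → X → Set} → I ≼ L → (∀ i → Small (B i)) → Small (λ x → ∃ λ i → B i x)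
  small-⋃ {X} {I} {B} I≼L small = (λ x → code (em {P = ∃ λ i → B i x})) , λ p q → code-injective p q em em
    where
    code : ∀ {x} → Dec (∃ λ i → B i x) → L
    code {x} (yes (i , _)) = Injection.to pairs (Injection.to I≼L i , proj₁ (small i) x)
    code     (no _)        = l₀

    code-injective : ∀ {x y} → (∃ λ i → B i x) → (∃ λ i → B i y) →
      (d : Dec (∃ λ i → B i x)) (d′ : Dec (∃ λ i → B i y)) → code d ≡ code d′ → x ≡ y
    code-injective p q (no ¬p)       _             _ = contradiction p ¬p
    code-injective p q (yes _)       (no ¬q)       _ = contradiction q ¬q
    code-injective {x} {y} _ _ (yes (i , p)) (yes (j , q)) e
      with Injection.injective pairs e
    ... | e′ with Injection.injective I≼L (cong proj₁ e′)
    ... | refl = proj₂ (small i) p q (cong proj₂ e′)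

  small-∪ : ∀ {X} {B D : X → Set} → Small B → Small D → Small (λ x → B x ⊎ D x)
  small-∪ {X} {B} {D} b d = small-⊆ (λ { x (inj₁ p) → true , p ; x (inj₂ q) → false , q })
    (small-⋃ {B = λ i → if i then B else D} bits λ { true → b ; false → d })

  cantor-not-small : ∀ {B : Cantor → Set} → (∀ x → B x) → ¬ Small B
  cantor-not-small all (f , inj) = L-uncountable (mk↣ (inj (all _) (all _)))

  cons-injective : ∀ b → Injective _≡_ _≡_ (cons b)
  cons-injective b e = ext λ n → cong-app e (suc n)

  private module Nodes = Counting em {T = Cantor → Set} (λ b A → A ∘ cons b)

  -- The number of words s of length n such that A contains the cone of s up to
  -- |L| many points; mass A n / 2ⁿ increases to the measure of A.
  mass : (Cantor → Set) → ℕ → ℕ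
  mass A n = Nodes.count (λ A → Small (¬_ ∘ A)) n A

  mass-≤ : ∀ A n → mass A n ≤ 2^ n
  mass-≤ A n = Nodes.count-≤ _ n A

  mass-doubling : ∀ A n → 2 * mass A n ≤ mass A (suc n)
  mass-doubling A n = Nodes.count-doubling _ (λ b A → small-∘ (cons-injective b)) n A

  mass-mono : ∀ {A B} → (∀ x → A x → B x) → ∀ n → mass A n ≤ mass B n
  mass-mono A⊆B zero    = indicator-mono (small-⊆ (λ x ¬b a → ¬b (A⊆B x a))) em em
  mass-mono A⊆B (suc n) = +-mono-≤ (mass-mono (A⊆B ∘ cons false) n) (mass-mono (A⊆B ∘ cons true) n)

  -- No cone counts for both sets: otherwise the complements of two disjoint sets would be small in
  -- it, and they cover a copy of the Cantor space.
  mass-disjoint : ∀ {A B} → (∀ x → A x → ¬ B x) → ∀ n → mass A n + mass B n ≤ mass (λ x → A x ⊎ B x) n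
  mass-disjoint {A} {B} disj zero = incompatible em em em
    where
    incompatible : (p : Dec (Small (¬_ ∘ A))) (q : Dec (Small (¬_ ∘ B)))
      (r : Dec (Small (λ x → ¬ (A x ⊎ B x)))) → indicator p + indicator q ≤ indicator r
    incompatible (yes p) (yes q) _ = contradiction (small-∪ p q) (cantor-not-small outside)
      where
      outside : ∀ x → (¬ A x) ⊎ (¬ B x)
      outside x with em {P = A x}
      ... | yes a = inj₂ (disj x a)
      ... | no ¬a = inj₁ ¬a
    incompatible (yes p) (no _) r = indicator-mono (small-⊆ λ x n a → n (inj₁ a)) (yes p) r
    incompatible (no _) q       r = indicator-mono (small-⊆ λ x n b → n (inj₂ b)) q r
  mass-disjoint {A} {B} disj (suc n) = ≤-trans
    (≤-reflexive (interchange (mass (A ∘ cons false) n) _ (mass (B ∘ cons false) n) _))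
    (+-mono-≤ (mass-disjoint (disj ∘ cons false) n) (mass-disjoint (disj ∘ cons true) n))

  -- A cone counted for a small set would be the union of two small sets, hence small.
  mass-small : ∀ {A} → Small A → ∀ n → mass A n ≤ 0
  mass-small {A} small zero = bothSmall em
    where
    bothSmall : (d : Dec (Small (¬_ ∘ A))) → indicator d ≤ 0
    bothSmall (no _)  = z≤n
    bothSmall (yes s) = contradiction (small-∪ small s) (cantor-not-small decide)
      where
      decide : ∀ x → A x ⊎ (¬ A x)
      decide x with em {P = A x}
      ... | yes a = inj₁ a
      ... | no ¬a = inj₂ ¬a
  mass-small {A} small (suc n) = +-mono-≤ (mass-small {A ∘ cons false} (small-∘ (cons-injective false) small) n)
                                          (mass-small {A ∘ cons true} (small-∘ (cons-injective true) small) n)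

  mass-full : ∀ {A} → (∀ x → A x) → ∀ n → 2^ n ≤ mass A n
  mass-full {A} all zero = indicator-mono {P = ⊤}
    (λ _ → small-singleton λ x _ ¬a → contradiction (all x) ¬a) (yes tt) em
  mass-full {A} all (suc n) = +-mono-≤ (mass-full {A ∘ cons false} (all ∘ cons false) n)
    (≤-trans (≤-reflexive (+-identityʳ _)) (mass-full {A ∘ cons true} (all ∘ cons true) n))

  mass-nbhd : ∀ {A} n x → (∀ y → Agree n x y → A y) → 1 ≤ mass A n
  mass-nbhd {A} zero    x sub = mass-full {A} (λ y → sub y λ _ ()) 0
  mass-nbhd {A} (suc n) x sub = side (x 0) refl
    where
    extend : ∀ b → x 0 ≡ b → ∀ {y} → Agree n (x ∘ suc) y → Agree (suc n) x (cons b y)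
    extend b e p zero    _         = e
    extend b e p (suc k) (s≤s k<n) = p k k<n

    side : ∀ b → x 0 ≡ b → 1 ≤ mass A (suc n)
    side false e = ≤-trans (mass-nbhd {A ∘ cons false} n (x ∘ suc) (λ y p → sub (cons false y) (extend false e p)))
                           (m≤m+n _ _)
    side true  e = ≤-trans (mass-nbhd {A ∘ cons true} n (x ∘ suc) (λ y p → sub (cons true y) (extend true e p)))
                           (m≤n+m _ _)

  -- Such a set lies in a single cone of level `n`: at each of the first `n` levels one half is
  -- empty and contributes nothing.
  mass-agree : ∀ {A} n m → (∀ x y → A x → A y → Agree n x y) → mass A (n + m) ≤ 2^ m
  mass-agree {A} zero    m _     = mass-≤ A m
  mass-agree {A} (suc n) m agree = side em
    where
    half : ∀ b → mass (A ∘ cons b) (n + m) ≤ 2^ m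
    half b = mass-agree {A ∘ cons b} n m λ x y p q k k<n → agree (cons b x) (cons b y) p q (suc k) (s≤s k<n)

    none : ∀ b → (∀ x → ¬ A (cons b x)) → mass (A ∘ cons b) (n + m) ≤ 0
    none b void = mass-small {A ∘ cons b} (small-singleton λ x _ p → contradiction p (void x)) (n + m)

    side : Dec (∃ λ x → A (cons false x)) → mass A (suc n + m) ≤ 2^ m
    side (no void)    = +-mono-≤ (none false λ x p → void (x , p)) (half true)
    side (yes (x , p)) = ≤-trans (+-mono-≤ (half false) (none true λ y q → apart y q))
                                 (≤-reflexive (+-identityʳ _))
      where
      apart : ∀ y → ¬ A (cons true y)
      apart y q with agree (cons false x) (cons true y) p q 0 (s≤s z≤n)
      ... | ()

  IsOpen : (Cantor → Set) → Set
  IsOpen A = ∀ x → A x → ∃ λ n → ∀ y → Agree n x y → A y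

  open-cons : ∀ b {A} → IsOpen A → IsOpen (A ∘ cons b)
  open-cons b o x a with o (cons b x) a
  ... | n , sub = n , λ y p → sub (cons b y) λ { zero _ → refl ; (suc k) k<n → p k (<-trans (n<1+n k) k<n) }

  -- Approximating unions of open sets by cones inside single members.

  module Covering {I : Set} where

    Family : Set₁
    Family = I → Cantor → Set

    child : Bool → Family → Family
    child b U i = U i ∘ cons b

    open Counting em child public

    Covered : Family → Set
    Covered U = ∃ λ i → ∀ x → U i x

    covered uncovered : Family → ℕ → ℕ
    covered   U n = count Covered n U
    uncovered U n = count (¬_ ∘ Covered) n U

    covered-doubling : ∀ U n → 2 * covered U n ≤ covered U (suc n)
    covered-doubling U n = count-doubling Covered (λ b U (i , all) → i , all ∘ cons b) n U

    -- The complementary form of `covered-doubling`: the proportion of uncovered words does not grow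
    -- with the level.
    uncovered-halving : ∀ U n → uncovered U (suc n) ≤ 2 * uncovered U n
    uncovered-halving U n = +-cancelˡ-≤ (2 * covered U n) _ _ (begin
      2 * covered U n + uncovered U (suc n)       ≤⟨ +-monoˡ-≤ _ (covered-doubling U n) ⟩
      covered U (suc n) + uncovered U (suc n)     ≡⟨ count-complement Covered (suc n) U ⟩
      2 * 2^ n                                    ≡⟨ cong (2 *_) (sym (count-complement Covered n U)) ⟩
      2 * (covered U n + uncovered U n)           ≡⟨ *-distribˡ-+ 2 (covered U n) _ ⟩
      2 * covered U n + 2 * uncovered U n         ∎)
      where open ≤-Reasoning

    -- The proportion of cones not inside a member of U drops to at most b / a.
    Defect : ℕ → ℕ → Family → Set
    Defect a b U = ∃ λ m → uncovered U m * a ≤ b * 2^ m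

    defect-raise : ∀ U {a b m} k → uncovered U m * a ≤ b * 2^ m → uncovered U (k + m) * a ≤ b * 2^ (k + m)
    defect-raise U         zero    p = p
    defect-raise U {a} {b} {m} (suc k) p = begin
      uncovered U (suc (k + m)) * a   ≤⟨ *-monoˡ-≤ a (uncovered-halving U (k + m)) ⟩
      2 * uncovered U (k + m) * a     ≡⟨ *-assoc 2 (uncovered U (k + m)) a ⟩
      2 * (uncovered U (k + m) * a)   ≤⟨ *-monoʳ-≤ 2 (defect-raise U {a} {b} {m} k p) ⟩
      2 * (b * 2^ (k + m))            ≡⟨ swap b (2^ (k + m)) ⟩
      b * 2^ suc (k + m)              ∎
      where
      open ≤-Reasoning
      swap : ∀ b c → 2 * (b * c) ≡ b * (2 * c)
      swap = solve-∀

    -- The proportion missed in a cone is the average of those missed in its halves.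
    defect-step : ∀ U {a b b′} → Defect a b (child false U) → Defect a b′ (child true U) →
                  Defect (2 * a) (b + b′) U
    defect-step U {a} {b} {b′} (m , p) (m′ , p′) = suc (m + m′) , (begin
      (u + v) * (2 * a)             ≡⟨ arrange u v a ⟩
      2 * (u * a + v * a)           ≤⟨ *-monoʳ-≤ 2 (+-mono-≤
          (subst (λ i → uncovered (child false U) i * a ≤ b * 2^ i) (+-comm m′ m) (defect-raise (child false U) {a} {b} {m} m′ p))
          (defect-raise (child true U) {a} {b′} {m′} m p′)) ⟩
      2 * (b * 2^ (m + m′) + b′ * 2^ (m + m′)) ≡⟨ collect b b′ (2^ (m + m′)) ⟩
      (b + b′) * 2^ suc (m + m′)    ∎)
      where
      open ≤-Reasoning
      u = uncovered (child false U) (m + m′)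
      v = uncovered (child true U) (m + m′)

      arrange : ∀ u v a → (u + v) * (2 * a) ≡ 2 * (u * a + v * a)
      arrange = solve-∀

      collect : ∀ b b′ c → 2 * (b * c + b′ * c) ≡ (b + b′) * (2 * c)
      collect = solve-∀

    AlmostCovered : Family → Set
    AlmostCovered U = ∀ a → Defect a 1 U

    -- A finite path to a node neither half of which is almost covered. The path is kept as data so
    -- that `branch` can follow it.
    data Splits (U : Family) : Set where
      here  : (∀ b → ¬ AlmostCovered (child b U)) → Splits U
      below : ∀ b → Splits (child b U) → Splits U

    -- Without splitting, one half of every cone is almost covered: if ε = 1 / a of it
    -- is missed, the bound r on the proportion missed improves to (ε + r) / 2.
    unsplit-defect : ∀ U → ¬ Splits U → ∀ a j → Defect (a * 2^ j) (a + 2^ j) U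
    -- For positive `a` the claimed bound is `1 / a + 2⁻ʲ`, which at `j = 0` is more than the whole
    -- cone.
    unsplit-defect U ¬split a zero = 0 , (begin
      uncovered U 0 * (a * 1)  ≤⟨ *-monoˡ-≤ (a * 1) (count-≤ (¬_ ∘ Covered) 0 U) ⟩
      1 * (a * 1)              ≡⟨ unit a ⟩
      a                        ≤⟨ m≤m+n a 1 ⟩
      a + 1                    ≡⟨ sym (*-identityʳ _) ⟩
      (a + 1) * 1              ∎)
      where
      open ≤-Reasoning
      unit : ∀ a → 1 * (a * 1) ≡ a
      unit = solve-∀
    unsplit-defect U ¬split a (suc j) = halves em em
      where
      rest : ∀ b → Defect (a * 2^ j) (a + 2^ j) (child b U)
      rest b = unsplit-defect (child b U) (¬split ∘ below b) a j

      tiny : ∀ b → AlmostCovered (child b U) → Defect (a * 2^ j) (2^ j) (child b U)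
      tiny b almost with almost a
      ... | m , p = m , (begin
        uncovered (child b U) m * (a * 2^ j)   ≡⟨ sym (*-assoc (uncovered (child b U) m) a _) ⟩
        uncovered (child b U) m * a * 2^ j     ≤⟨ *-monoˡ-≤ (2^ j) p ⟩
        1 * 2^ m * 2^ j                        ≡⟨ swap (2^ m) (2^ j) ⟩
        2^ j * 2^ m                            ∎)
        where
        open ≤-Reasoning
        swap : ∀ m j → 1 * m * j ≡ j * m
        swap = solve-∀

      conclude : ∀ {c} → c ≡ a + 2^ suc j → Defect (2 * (a * 2^ j)) c U →
                 Defect (a * 2^ suc j) (a + 2^ suc j) U
      conclude refl (m , p) = m , ≤-trans (≤-reflexive (cong (uncovered U m *_) (swap a (2^ j)))) p
        where
        swap : ∀ a j → a * (2 * j) ≡ 2 * (a * j)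
        swap = solve-∀

      leftTiny : ∀ a j → j + (a + j) ≡ a + 2 * j
      leftTiny = solve-∀

      rightTiny : ∀ a j → (a + j) + j ≡ a + 2 * j
      rightTiny = solve-∀

      halves : Dec (AlmostCovered (child false U)) → Dec (AlmostCovered (child true U)) →
               Defect (a * 2^ suc j) (a + 2^ suc j) U
      halves (yes p) _       = conclude (leftTiny a (2^ j)) (defect-step U {b = 2^ j} {a + 2^ j} (tiny false p) (rest true))
      halves (no _)  (yes q) = conclude (rightTiny a (2^ j)) (defect-step U {b = a + 2^ j} {2^ j} (rest false) (tiny true q))
      halves (no ¬p) (no ¬q) = contradiction (here λ { false → ¬p ; true → ¬q }) ¬split

    unsplit⇒almostCovered : ∀ U → ¬ Splits U → AlmostCovered U
    -- With `2 * a` for both parameters the bound is `1 / 2a + 2⁻²ᵃ`, which is at most `1 / a`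
    -- because `2a ≤ 2²ᵃ`.
    unsplit⇒almostCovered U ¬split a with unsplit-defect U ¬split (2 * a) (2 * a)
    ... | m , p = m , *-cancelʳ-≤ _ _ (2 * 2^ (2 * a)) {{>-nonZero (≤-trans (1≤2^ (2 * a)) (m≤m+n _ _))}} (begin
      uncovered U m * a * (2 * 2^ (2 * a))      ≡⟨ swap (uncovered U m) a (2^ (2 * a)) ⟩
      uncovered U m * (2 * a * 2^ (2 * a))      ≤⟨ p ⟩
      (2 * a + 2^ (2 * a)) * 2^ m               ≤⟨ *-monoˡ-≤ (2^ m) (+-monoˡ-≤ _ (n≤2^n (2 * a))) ⟩
      (2^ (2 * a) + 2^ (2 * a)) * 2^ m          ≡⟨ collect (2^ (2 * a)) (2^ m) ⟩
      1 * 2^ m * (2 * 2^ (2 * a))               ∎)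
      where
      open ≤-Reasoning

      swap : ∀ u a j → u * a * (2 * j) ≡ u * (2 * a * j)
      swap = solve-∀

      collect : ∀ j m → (j + j) * m ≡ 1 * m * (2 * j)
      collect = solve-∀

    splits : ∀ {U} → ¬ AlmostCovered U → Splits U
    splits {U} ¬almost with em {P = Splits U}
    ... | yes s = s
    ... | no ¬s = contradiction (unsplit⇒almostCovered U ¬s) ¬almost

    covered⇒almostCovered : ∀ {U} → Covered U → AlmostCovered U
    covered⇒almostCovered {U} c a = 0 , ≤-trans (≤-reflexive (cong (_* a) (none em))) z≤n
      where
      none : (d : Dec (¬ Covered U)) → indicator d ≡ 0
      none (yes ¬c) = contradiction c ¬c
      none (no _)   = refl

    splits⇒uncovered : ∀ {U} → Splits U → ¬ Covered U
    splits⇒uncovered (here ¬almost) (i , all) = ¬almost false (covered⇒almostCovered (i , all ∘ cons false))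
    splits⇒uncovered (below b s)    (i , all) = splits⇒uncovered s (i , all ∘ cons b)

    -- The path in `Splits` is followed to the splitting node; there one bit of `x` chooses the
    -- half, which is again not almost covered and so splits further. This embeds the full binary
    -- tree as a perfect subtree.
    branch : ∀ {U} → Splits U → Cantor → Cantor
    branch (here ¬almost) x zero    = x 0
    branch (here ¬almost) x (suc k) = branch (splits (¬almost (x 0))) (x ∘ suc) k
    branch (below b s)    x zero    = b
    branch (below b s)    x (suc k) = branch s x k

    -- Every node on the branch still has a splitting node at or below it, and so lies in no member
    -- of the family.
    branch-avoids : ∀ n {U} (s : Splits U) x {i} → ¬ (∀ y → Agree n (branch s x) y → U i y)
    branch-avoids zero    s x {i} sub = splits⇒uncovered s (i , λ y → sub y λ _ ())
    branch-avoids (suc n) (here ¬almost) x sub =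
      branch-avoids n (splits (¬almost (x 0))) (x ∘ suc) λ y p → sub (cons (x 0) y)
        λ { zero _ → refl ; (suc k) (s≤s k<n) → p k k<n }
    branch-avoids (suc n) (below b s) x sub =
      branch-avoids n s x λ y p → sub (cons b y) λ { zero _ → refl ; (suc k) (s≤s k<n) → p k k<n }

    branch-injective : ∀ n {U} (s : Splits U) x y → (∀ k → branch s x k ≡ branch s y k) → x n ≡ y n
    branch-injective zero    (here ¬almost) x y e = e 0
    branch-injective (suc n) (here ¬almost) x y e =
      branch-injective n (splits (¬almost (x 0))) (x ∘ suc) (y ∘ suc) λ k →
        -- The tree below a splitting node depends on the bit read there, so the branch of `y` is
        -- transported to the half chosen by `x`.
        subst (λ b → branch (splits (¬almost (x 0))) (x ∘ suc) k ≡ branch (splits (¬almost b)) (y ∘ suc) k)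
              (sym (e 0)) (e (suc k))
    branch-injective n       (below b s)    x y e = branch-injective n s x y (e ∘ suc)

    -- Otherwise `branch` maps the Cantor space injectively into the points outside all `U i`: by
    -- openness, a branch in `U i` would have a whole cone in `U i`. The small set of missed points
    -- would then contain a copy of the Cantor space.
    small⇒almostCovered : ∀ U → (∀ i → IsOpen (U i)) → Small (λ x → ¬ ∃ λ i → U i x) → AlmostCovered U
    small⇒almostCovered U open′ (f , inj) with em {P = AlmostCovered U}
    ... | yes a = a
    ... | no ¬a = contradiction (mk↣ {to = f ∘ branch (splits ¬a)} λ {x} {y} e →
        ext λ n → branch-injective n (splits ¬a) x y (cong-app (inj (avoid x) (avoid y) e))) L-uncountable
      where
      avoid : ∀ x → ¬ ∃ λ i → U i (branch (splits ¬a) x)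
      avoid x (i , u) with open′ i _ u
      ... | n , sub = branch-avoids n (splits ¬a) x sub

    -- In a cone counted by `mass B n` the `U i` miss only a small set, so `small⇒almostCovered`
    -- applies there. After division the claim bounds `mass B n / 2ⁿ` by
    -- `covered U (n + m) / 2ⁿ⁺ᵐ + 1 / a`.
    mass-covered : ∀ n U B → (∀ i → IsOpen (U i)) → Small (λ x → B x × ¬ ∃ λ i → U i x) → ∀ a →
      ∃ λ m → mass B n * 2^ m * a ≤ covered U (n + m) * a + 2^ (n + m)
    mass-covered zero U B o small a = whole em
      where
      whole : (d : Dec (Small (¬_ ∘ B))) → ∃ λ m → indicator d * 2^ m * a ≤ covered U m * a + 2^ m
      whole (no _)  = 0 , z≤n
      whole (yes s) with small⇒almostCovered U o (small-⊆ decide (small-∪ s small)) a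
        where
        decide : ∀ x → (¬ ∃ λ i → U i x) → (¬ B x) ⊎ (B x × ¬ ∃ λ i → U i x)
        decide x ¬u with em {P = B x}
        ... | yes b = inj₂ (b , ¬u)
        ... | no ¬b = inj₁ ¬b
      ... | m , p = m , (begin
        1 * 2^ m * a                             ≡⟨ cong (_* a) (*-identityˡ (2^ m)) ⟩
        2^ m * a                                 ≡⟨ cong (_* a) (sym (count-complement Covered m U)) ⟩
        (covered U m + uncovered U m) * a        ≡⟨ *-distribʳ-+ a (covered U m) _ ⟩
        covered U m * a + uncovered U m * a      ≤⟨ +-monoʳ-≤ (covered U m * a) p ⟩
        covered U m * a + 1 * 2^ m               ≡⟨ cong (covered U m * a +_) (*-identityˡ _) ⟩
        covered U m * a + 2^ m                   ∎)
        where open ≤-Reasoning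
    mass-covered (suc n) U B o small a
      with mass-covered n (child false U) (B ∘ cons false) (λ i → open-cons false (o i)) (small-∘ (cons-injective false) small) a
         | mass-covered n (child true U) (B ∘ cons true) (λ i → open-cons true (o i)) (small-∘ (cons-injective true) small) a
    ... | m , p | m′ , p′ = m + m′ , (begin
      (u + v) * 2^ (m + m′) * a         ≡⟨ arrange u v (2^ (m + m′)) a ⟩
      u * 2^ (m + m′) * a + v * 2^ (m + m′) * a
        ≤⟨ +-mono-≤ (subst (λ i → u * 2^ i * a ≤ covered (child false U) (n + i) * a + 2^ (n + i)) (+-comm m′ m)
                           (later (child false U) u m′ {m} p))
                    (later (child true U) v m {m′} p′) ⟩
      (d * a + 2^ (n + (m + m′))) + (e * a + 2^ (n + (m + m′)))  ≡⟨ collect d e a (2^ (n + (m + m′))) ⟩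
      (d + e) * a + 2^ (suc n + (m + m′))  ∎)
      where
      open ≤-Reasoning
      u = mass (B ∘ cons false) n
      v = mass (B ∘ cons true) n
      d = covered (child false U) (n + (m + m′))
      e = covered (child true U) (n + (m + m′))

      arrange : ∀ u v t a → (u + v) * t * a ≡ u * t * a + v * t * a
      arrange = solve-∀

      collect : ∀ d e a t → (d * a + t) + (e * a + t) ≡ (d + e) * a + 2 * t
      collect = solve-∀

      shuffle₁ : ∀ w t a → w * (2 * t) * a ≡ 2 * (w * t * a)
      shuffle₁ = solve-∀

      shuffle₂ : ∀ c t a → 2 * (c * a + t) ≡ 2 * c * a + 2 * t
      shuffle₂ = solve-∀

      later : ∀ U w k {m} → w * 2^ m * a ≤ covered U (n + m) * a + 2^ (n + m) →
              w * 2^ (k + m) * a ≤ covered U (n + (k + m)) * a + 2^ (n + (k + m))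
      later U w zero    p = p
      later U w (suc k) {m} p = begin
        w * (2 * 2^ (k + m)) * a                                    ≡⟨ shuffle₁ w (2^ (k + m)) a ⟩
        2 * (w * 2^ (k + m) * a)                                    ≤⟨ *-monoʳ-≤ 2 (later U w k {m} p) ⟩
        2 * (covered U (n + (k + m)) * a + 2^ (n + (k + m)))        ≡⟨ shuffle₂ (covered U (n + (k + m))) (2^ (n + (k + m))) a ⟩
        2 * covered U (n + (k + m)) * a + 2^ suc (n + (k + m))      ≤⟨ +-monoˡ-≤ _ (*-monoˡ-≤ a (covered-doubling U (n + (k + m)))) ⟩
        covered U (suc (n + (k + m))) * a + 2^ suc (n + (k + m))    ≡⟨ cong (λ i → covered U i * a + 2^ i) (sym (+-suc n (k + m))) ⟩
        covered U (n + suc (k + m)) * a + 2^ (n + suc (k + m))      ∎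

    -- `F` collects one member for each covered cone of level `n`. Allowing every `G` containing `F`
    -- lets the lists of the two halves be concatenated, and duplicates be removed later.
    covered-≤ : ∀ n (U A : Family) → (∀ i x → U i x → A i x) →
                ∃ λ (F : List I) → ∀ {G} → F ⊆ G → covered U n ≤ Σ[ G ] (λ i → mass (A i) n)
    covered-≤ zero U A U⊆A = single em
      where
      single : (d : Dec (Covered U)) → ∃ λ (F : List I) → ∀ {G} → F ⊆ G → indicator d ≤ Σ[ G ] (λ i → mass (A i) 0)
      single (no _)          = [] , λ _ → z≤n
      single (yes (i , all)) = i ∷ [] , λ sub →
        ≤-trans (mass-full {A i} (λ x → U⊆A i x (all x)) 0) (term-≤-Σ (λ i → mass (A i) 0) (sub (here refl)))
    covered-≤ (suc n) U A U⊆A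
      with covered-≤ n (child false U) (child false A) (λ i → U⊆A i ∘ cons false)
         | covered-≤ n (child true U) (child true A) (λ i → U⊆A i ∘ cons true)
    ... | F , p | F′ , p′ = F ++ F′ , λ {G} sub → ≤-trans
      (+-mono-≤ (p (sub ∘ ∈-++⁺ˡ)) (p′ (sub ∘ ∈-++⁺ʳ F)))
      (≤-reflexive (sym (Σ-+ G (λ i → mass (A i ∘ cons false) n) (λ i → mass (A i ∘ cons true) n))))

    mass-⋃ : ∀ (A : Family) → (∀ i j → i ≢ j → ∀ x → A i x → ¬ A j x) → ∀ n {F} → Unique F →
             Σ[ F ] (λ i → mass (A i) n) ≤ mass (λ x → ∃ λ i → A i x) n
    mass-⋃ A disj n {F} uq = ≤-trans (listed uq) (mass-mono (λ { x (i , _ , a) → i , a }) n)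
      where
      listed : ∀ {F} → Unique F → Σ[ F ] (λ i → mass (A i) n) ≤ mass (λ x → ∃ λ i → i ∈ F × A i x) n
      listed {[]}    _          = z≤n
      listed {j ∷ F} (j∉F ∷ uq) = ≤-trans (+-monoʳ-≤ (mass (A j) n) (listed uq))
        (≤-trans (mass-disjoint (λ { x a (i , i∈F , a′) → disj j i (All.lookup j∉F i∈F) x a a′ }) n)
                 (mass-mono (λ { x (inj₁ a) → j , here refl , a ; x (inj₂ (i , i∈F , a)) → i , there i∈F , a }) n))

-- Estimates with dyadic slack.

≲0⇒≤1 : ∀ {x} → x ≲ 0ᴰ → ∀ n → at x n ≤ 1
≲0⇒≤1 p n with bound p n
... | m , q = *-cancelˡ-≤ (2^ m) {{>-nonZero (1≤2^ m)}} (≤-trans q (≤-reflexive (sym (*-identityʳ _))))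

-- The hypotheses bound M / 2ⁿ by C / 2ⁿ⁺ᵖ + ½ 2⁻ⁿ, then C by T and T by t.
≲-combine : ∀ T t {M C} n p k → M * 2^ p * (2 * 2^ n) ≤ C * (2 * 2^ n) + 2^ (n + p) → C ≤ at T (n + p) →
            2^ k * at T (suc (n + p)) ≤ at t (k + suc (n + p)) + 2^ k →
            2^ suc (k + p) * M ≤ at t (suc (k + p) + n) + 2^ suc (k + p)
≲-combine T t {M} {C} n p k q C≤T r = begin
  2 * 2^ (k + p) * M                          ≡⟨ cong (λ e → 2 * e * M) (2^-+ k p) ⟩
  2 * (2^ k * 2^ p) * M                       ≡⟨ arrange (2^ k) (2^ p) M ⟩
  2^ k * (M * 2^ p * 2)                       ≤⟨ *-monoʳ-≤ (2^ k) (*-cancelʳ-≤ _ _ (2^ n) {{>-nonZero (1≤2^ n)}} scaled) ⟩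
  2^ k * (C * 2 + 2^ p)                       ≡⟨ *-distribˡ-+ (2^ k) (C * 2) (2^ p) ⟩
  2^ k * (C * 2) + 2^ k * 2^ p                ≤⟨ +-monoˡ-≤ _ (*-monoʳ-≤ (2^ k) twice) ⟩
  2^ k * at T (suc (n + p)) + 2^ k * 2^ p     ≤⟨ +-monoˡ-≤ _ r ⟩
  at t (k + suc (n + p)) + 2^ k + 2^ k * 2^ p
    ≤⟨ +-monoˡ-≤ _ (+-monoʳ-≤ (at t (k + suc (n + p))) (m≤m*n (2^ k) (2^ p) {{>-nonZero (1≤2^ p)}})) ⟩
  at t (k + suc (n + p)) + 2^ k * 2^ p + 2^ k * 2^ p
                                              ≡⟨ collect (at t (k + suc (n + p))) (2^ k * 2^ p) ⟩
  at t (k + suc (n + p)) + 2 * (2^ k * 2^ p)  ≡⟨ cong₂ (λ i e → at t i + 2 * e) (rotate k n p) (sym (2^-+ k p)) ⟩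
  at t (suc (k + p) + n) + 2^ suc (k + p)     ∎
  where
  open ≤-Reasoning

  arrange : ∀ k p m → 2 * (k * p) * m ≡ k * (m * p * 2)
  arrange = solve-∀

  collect : ∀ a b → a + b + b ≡ a + 2 * b
  collect = solve-∀

  rotate : ∀ k n p → k + suc (n + p) ≡ suc (k + p) + n
  rotate = solve-∀

  regroup₁ : ∀ m p n → m * p * 2 * n ≡ m * p * (2 * n)
  regroup₁ = solve-∀

  regroup₂ : ∀ c n p → c * (2 * n) + n * p ≡ (c * 2 + p) * n
  regroup₂ = solve-∀

  twice : C * 2 ≤ at T (suc (n + p))
  twice = ≤-trans (≤-reflexive (*-comm C 2)) (≤-trans (*-monoʳ-≤ 2 C≤T) (doubling T (n + p)))

  scaled : M * 2^ p * 2 * 2^ n ≤ (C * 2 + 2^ p) * 2^ n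
  scaled = begin
    M * 2^ p * 2 * 2^ n              ≡⟨ regroup₁ M (2^ p) (2^ n) ⟩
    M * 2^ p * (2 * 2^ n)            ≤⟨ q ⟩
    C * (2 * 2^ n) + 2^ (n + p)      ≡⟨ cong (C * (2 * 2^ n) +_) (2^-+ n p) ⟩
    C * (2 * 2^ n) + 2^ n * 2^ p     ≡⟨ regroup₂ C (2^ n) (2^ p) ⟩
    (C * 2 + 2^ p) * 2^ n            ∎

-- An infinite well-order with finite initial segments is isomorphic to ω.

module Enumeration (em : ∀ {ℓ} → ExcludedMiddle ℓ) (κ : Ordinal) (infinite : ℕ ≼ Ordinal.Carrier κ)
  (finite-segments : ∀ a → ¬ (ℕ ≼ Ordinal.Carrier (κ ↓ a))) where

  private
    K = Ordinal.Carrier κ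
    module < = IsStrictTotalOrder (Ordinal.isStrictTotalOrder κ)

  no-sequence-below : ∀ {a} (f : ℕ → K) → Injective _≡_ _≡_ f → ¬ (∀ n → Lt κ (f n) a)
  no-sequence-below {a} f inj f<a = finite-segments a (mk↣ {to = λ n → f n , f<a n} (inj ∘ cong proj₁))

  no-maximum : ∀ a → ∃ λ b → Lt κ a b
  no-maximum a with em {P = ∃ λ b → Lt κ a b}
  ... | yes r = r
  ... | no ¬r = avoid em
    where
    f = Injection.to infinite

    below : ∀ b → b ≢ a → Lt κ b a
    below b b≢a with <.compare b a
    ... | tri< b<a _ _ = b<a
    ... | tri≈ _ e _   = contradiction e b≢a
    ... | tri> _ _ a<b = contradiction (b , a<b) ¬r

    avoid : Dec (∃ λ n → f n ≡ a) → ∃ λ b → Lt κ a b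
    avoid (no missed)   = contradiction (λ n → below (f n) λ e → missed (n , e))
      (no-sequence-below f (Injection.injective infinite))
    -- Dropping the first `suc n` terms removes the one term equal to `a`; the rest is an infinite
    -- sequence below `a`.
    avoid (yes (n , e)) = contradiction
      (λ m → below (f (suc n + m)) λ e′ → m+1+n≢m n (trans (+-suc n m) (Injection.injective infinite (trans e′ (sym e)))))
      (no-sequence-below (λ m → f (suc n + m)) (+-cancelˡ-≡ (suc n) _ _ ∘ Injection.injective infinite))

  Least : (K → Set) → K → Set
  Least P a = P a × (∀ b → P b → ¬ Lt κ b a)

  least : (P : K → Set) → ∃ P → ∃ (Least P)
  least P (a , p) = descend a (Ordinal.wellFounded κ a) p
    where
    descend : ∀ a → Acc (Lt κ) a → P a → ∃ (Least P)
    descend a (acc rs) p with em {P = ∃ λ b → P b × Lt κ b a}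
    ... | yes (b , q , b<a) = descend b (rs b<a) q
    ... | no none           = a , p , λ b q b<a → none (b , q , b<a)

  enum : ℕ → K
  enum zero    = proj₁ (least (λ _ → ⊤) (Injection.to infinite 0 , tt))
  enum (suc n) = proj₁ (least (Lt κ (enum n)) (no-maximum (enum n)))

  enum-least : ∀ n → Least (Lt κ (enum n)) (enum (suc n))
  enum-least n = proj₂ (least (Lt κ (enum n)) (no-maximum (enum n)))

  enum-mono : ∀ {m n} → m < n → Lt κ (enum m) (enum n)
  enum-mono {m} {suc n} m<1+n with m<1+n⇒m<n∨m≡n m<1+n
  ... | inj₁ m<n  = <.trans (enum-mono m<n) (proj₁ (enum-least n))
  ... | inj₂ refl = proj₁ (enum-least n)

  enum-injective : Injective _≡_ _≡_ enum
  enum-injective {m} {n} e with <-cmp m n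
  ... | tri< m<n _ _ = contradiction (enum-mono m<n) (<.irrefl e)
  ... | tri≈ _ m≡n _ = m≡n
  ... | tri> _ _ n<m = contradiction (enum-mono n<m) (<.irrefl (sym e))

  -- A point that is left out stays above every `enum n`, by induction and leastness, and would have
  -- infinitely many predecessors.
  enum-surjective : ∀ a → ∃ λ n → enum n ≡ a
  enum-surjective a with em {P = ∃ λ n → enum n ≡ a}
  ... | yes r = r
  ... | no ¬r = contradiction below (no-sequence-below enum enum-injective)
    where
    below : ∀ n → Lt κ (enum n) a
    below n with <.compare (enum n) a
    ... | tri< e<a _ _ = e<a
    ... | tri≈ _ e _   = contradiction (n , e) ¬r
    below zero    | tri> _ _ a<e = contradiction a<e
      (proj₂ (proj₂ (least (λ _ → ⊤) (Injection.to infinite 0 , tt))) a tt)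
    below (suc n) | tri> _ _ a<e = contradiction a<e (proj₂ (enum-least n) a (below n))

  index : K → ℕ
  index a = proj₁ (enum-surjective a)

  enum-index : ∀ a → enum (index a) ≡ a
  enum-index a = proj₂ (enum-surjective a)

  index-enum : ∀ n → index (enum n) ≡ n
  index-enum n = enum-injective (enum-index (enum n))

  index-mono : ∀ {a b} → Lt κ a b → index a < index b
  index-mono {a} {b} a<b with <-cmp (index a) (index b)
  ... | tri< p _ _ = p
  ... | tri≈ _ e _ = contradiction a<b
    (<.irrefl (trans (sym (enum-index a)) (trans (cong enum e) (enum-index b))))
  ... | tri> _ _ p = contradiction a<b (<.asym (subst (λ c → Lt κ c a) (enum-index b)
    (subst (Lt κ (enum (index b))) (enum-index a) (enum-mono p))))

ω-isCardinal : IsCardinal ω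
ω-isCardinal a f = Fin.ℕ→Fin-notInjective code code-injective
  where
  preimage : ℕ → Ordinal.Carrier (ω ↓ a)
  preimage n = proj₁ (Bijection.surjective f n)

  preimage-injective : Injective _≡_ _≡_ preimage
  preimage-injective {m} {n} e = trans (sym (proj₂ (Bijection.surjective f m) refl))
    (trans (cong (Bijection.to f) e) (proj₂ (Bijection.surjective f n) refl))

  code : ℕ → Fin a
  code n = fromℕ< (proj₂ (preimage n))

  segment-≡ : ∀ {x y : Ordinal.Carrier (ω ↓ a)} → proj₁ x ≡ proj₁ y → x ≡ y
  segment-≡ {x , p} {.x , q} refl = cong (x ,_) (<-irrelevant p q)

  code-injective : Injective _≡_ _≡_ code
  code-injective e = preimage-injective (segment-≡ (Fin.fromℕ<-injective _ _ _ _ e))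

-- The measure space on `Λ ^ κ`.

module Construction (em : ∀ {ℓ} → ExcludedMiddle ℓ) (ext : ∀ {a b} → Extensionality a b)
  (κ Λ : Ordinal) (κ-infinite : ℕ ≼ Ordinal.Carrier κ) (Λ-infinite : ℕ ≼ Ordinal.Carrier Λ)
  (words : (Λ ^< κ) ≼ Ordinal.Carrier Λ) (Λ<𝔠 : ¬ (Cantor ≼ Ordinal.Carrier Λ)) where

  private
    K = Ordinal.Carrier κ
    L = Ordinal.Carrier Λ
    X = Λ ^ κ

  bit : Bool → L
  bit b = Injection.to Λ-infinite (if b then 1 else 0)

  bit-injective : Injective _≡_ _≡_ bit
  bit-injective {b} {b′} e = ifs b b′ (Injection.injective Λ-infinite e)
    where
    ifs : ∀ b b′ → (if b then 1 else 0) ≡ (if b′ then 1 else 0) → b ≡ b′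
    ifs false false _ = refl
    ifs true  true  _ = refl

  -- An infinite a < κ would give 2^ℵ₀ ≤ Λ^a ≤ Λ; hence κ = ω.
  finite-segments : ∀ a → ¬ (ℕ ≼ Ordinal.Carrier (κ ↓ a))
  finite-segments a h = Λ<𝔠 (mk↣ {to = Injection.to words ∘ code} λ {x} {y} e → ext λ n →
    bit-injective (trans (sym (spread-at x n em))
      (trans (cong-app (,-injectiveʳ (Injection.injective words e)) (Injection.to h n)) (spread-at y n em))))
    where
    -- Coordinate `h n` carries the bit `x n`; coordinates outside the range of `h` get the default
    -- `bit false`.
    spread : Cantor → ∀ {i} → Dec (∃ λ n → Injection.to h n ≡ i) → L
    spread x (yes (n , _)) = bit (x n)
    spread x (no _)        = bit false

    spread-at : ∀ x n (d : Dec (∃ λ m → Injection.to h m ≡ Injection.to h n)) → spread x d ≡ bit (x n)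
    spread-at x n (yes (m , e)) = cong (bit ∘ x) (Injection.injective h e)
    spread-at x n (no ¬p)       = contradiction (n , refl) ¬p

    code : Cantor → Λ ^< κ
    code x = a , λ i → spread x {i} em

  open Enumeration em κ κ-infinite finite-segments

  -- A pair is a word of length 2, and there are at most Λ many words.
  pairs : (L × L) ≼ L
  pairs = mk↣ {to = λ p → Injection.to words (enum 2 , λ i → entry p (index (proj₁ i)))} λ e →
    let e′ = ,-injectiveʳ (Injection.injective words e)
    in cong₂ _,_ (at-index 0 (s≤s z≤n) e′) (at-index 1 ≤-refl e′)
    where
    entry : L × L → ℕ → L
    entry (l , l′) zero    = l
    entry (l , l′) (suc _) = l′

    at-index : ∀ k → k < 2 → ∀ {p q} →
      _≡_ {A = Ordinal.Carrier (κ ↓ enum 2) → L} (λ i → entry p (index (proj₁ i))) (λ i → entry q (index (proj₁ i))) →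
      entry p k ≡ entry q k
    at-index k k<2 {p} {q} e = subst (λ j → entry p j ≡ entry q j) (index-enum k) (cong-app e (enum k , enum-mono k<2))

  open Smallness em ext L (mk↣ bit-injective) pairs Λ<𝔠

  embed : Cantor → X
  embed y a = bit (y (index a))

  embed-injective : Injective _≡_ _≡_ embed
  embed-injective {x} {y} e = ext λ n →
    subst (λ k → x k ≡ y k) (index-enum n) (bit-injective (cong-app e (enum n)))

  𝒯 = boundedTopology κ Λ
  open Topology 𝒯 using (Open)

  Cone : X → K → 𝒫 X
  Cone x a = 𝐍 {κ} {Λ} (a , x ∘ proj₁)

  cone-open : ∀ x a → Open (Cone x a)
  cone-open x a = basic (a , x ∘ proj₁)

  cone-⊆ : ∀ {x a b} → Lt κ a b → ∀ {z} → Cone x b z → Cone x a z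
  cone-⊆ a<b z∈ (c , c<a) = z∈ (c , IsStrictTotalOrder.trans (Ordinal.isStrictTotalOrder κ) c<a a<b)

  -- Induction on the generation of `O`; the cones around one point are nested, so an intersection
  -- takes the longer of two segments.
  open⇒cone : ∀ {O} → Open O → ∀ x → O x → ∃ λ a → ∀ {z} → Cone x a z → O z
  open⇒cone (basic (a , s))  x x∈       = a , λ z∈ i → trans (x∈ i) (z∈ i)
  open⇒cone (gen-resp P≐Q o) x x∈       = let a , sub = open⇒cone o x (proj₂ P≐Q x∈) in a , proj₁ P≐Q ∘ sub
  open⇒cone full             x x∈       = enum 0 , λ _ → _
  open⇒cone (union os)       x (j , x∈) = let a , sub = open⇒cone (os j) x x∈ in a , λ z∈ → j , sub z∈
  open⇒cone (inter o o′)     x (x∈ , x∈′) with open⇒cone o x x∈ | open⇒cone o′ x x∈′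
  ... | a , sub | b , sub′ with IsStrictTotalOrder.compare (Ordinal.isStrictTotalOrder κ) a b
  ...   | tri< a<b _ _  = b , λ z∈ → sub (cone-⊆ a<b z∈) , sub′ z∈
  ...   | tri≈ _ refl _ = a , λ z∈ → sub z∈ , sub′ z∈
  ...   | tri> _ _ b<a  = a , λ z∈ → sub z∈ , sub′ (cone-⊆ b<a z∈)

  cone-agree : ∀ {x} n y z → Cone x (enum n) (embed y) → Cone x (enum n) (embed z) → Agree n y z
  cone-agree n y z y∈ z∈ k k<n = subst (λ j → y j ≡ z j) (index-enum k)
    (bit-injective (trans (sym (y∈ (enum k , enum-mono k<n))) (z∈ (enum k , enum-mono k<n))))

  agree-cone : ∀ n {y z} → Agree n y z → Cone (embed y) (enum n) (embed z)
  agree-cone n p (b , b<a) = cong bit (p (index b) (subst (index b <_) (index-enum n) (index-mono b<a)))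

  open-embed : ∀ {O} → Open O → IsOpen (O ∘ embed)
  open-embed {O} o y y∈ with open⇒cone o (embed y) y∈
  ... | a , sub = index a , λ z p → sub λ (b , b<a) → cong bit (p (index b) (index-mono b<a))

  IsMeasurable : 𝒫 X → Set₁
  IsMeasurable A = ∃ λ U → Open U × (∀ x → U x → A x) × Small (λ x → A x × ¬ U x)

  open⇒measurable : ∀ {A} → Open A → IsMeasurable A
  open⇒measurable {A} o = A , o , (λ _ a → a) , small-singleton λ _ _ (a , ¬a) → contradiction a ¬a

  singleton-measurable : ∀ x → IsMeasurable (x ≡_)
  singleton-measurable x = (λ _ → ⊥) , empty , (λ _ ()) ,
    small-singleton λ _ _ (p , _) (q , _) → trans (sym p) q

  ⋃-measurable : ∀ {I : Set} {A : I → 𝒫 X} → I ≼ L → (∀ i → IsMeasurable (A i)) →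
                 IsMeasurable (λ x → ∃ λ i → A i x)
  ⋃-measurable I≼L m = (λ x → ∃ λ i → proj₁ (m i) x) , union (λ i → proj₁ (proj₂ (m i)))
    , (λ { x (i , u) → i , proj₁ (proj₂ (proj₂ (m i))) x u })
    , small-⊆ (λ { x ((i , a) , ¬u) → i , a , λ u → ¬u (i , u) }) (small-⋃ I≼L (λ i → proj₂ (proj₂ (proj₂ (m i)))))

  measurable : WeaklyMeasurable Λ 𝒯
  measurable = record
    { 𝔐        = IsMeasurable
    ; 𝔐-resp   = λ { (A⊆B , B⊆A) (U , o , sub , small) →
                   U , o , (λ x u → A⊆B (sub x u)) , small-⊆ (λ { x (b , ¬u) → B⊆A b , ¬u }) small }
    ; ⋃-closed = ⋃-measurable
    ; open⊆𝔐   = open⇒measurable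
    }

  𝕊 = dyadicMonoid em
  open InfiniteSums 𝕊 ⊕-comm public

  measure : 𝒫 X → Dyadic
  measure A = record { at = mass (A ∘ embed) ; doubling = mass-doubling (A ∘ embed) }

  measure-mono : ∀ A B → (∀ x → A x → B x) → measure A ≲ measure B
  measure-mono A B sub = pointwise⇒≲ (mass-mono {A ∘ embed} {B ∘ embed} (sub ∘ embed))

  measure-small : ∀ A → Small A → measure A ≃ 0ᴰ
  measure-small A small = pointwise⇒≲ (mass-small {A ∘ embed} (small-∘ embed-injective small)) , pointwise⇒≲ (λ _ → z≤n)

  total-at : ∀ {I : Set} (f : I → Dyadic) F n → at (total f F) n ≡ sum (map (λ i → at (f i) n) F)
  total-at f []      n = refl
  total-at f (x ∷ F) n = cong (at (f x) n +_) (total-at f F n)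

  -- The upper bound is finite additivity. For leastness, cones inside single open parts `U i` carry
  -- the measure of the union up to an arbitrarily small error, and at each level they involve only
  -- finitely many indices.
  measure-⋃ : ∀ {I : Set} (A : I → 𝒫 X) → (∀ i → IsMeasurable (A i)) →
              (∀ i j → i ≢ j → ∀ x → A i x → ¬ A j x) →
              I ≼ L → HasSum (measure ∘ A) (measure (λ x → ∃ λ i → A i x))
  measure-⋃ {I} A m disj I≼L = record
    { upper = λ (F , uq) → pointwise⇒≲ λ n → ≤-trans (≤-reflexive (total-at (measure ∘ A) F n))
        (mass-⋃ (λ i → A i ∘ embed) (λ i j i≢j x → disj i j i≢j (embed x)) n uq)
    ; least = λ t ub → limit-≤ λ n → approximate t ub n
    }
    where
    open Covering {I}

    U : I → 𝒫 X
    U i = proj₁ (m i)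

    ⋃A = λ x → ∃ λ i → A i (embed x)

    decide : DecidableEquality I
    decide i j = em

    finiteSubfamily : ∀ n → ∃ λ F → Unique F × covered (λ i → U i ∘ embed) n ≤ at (total (measure ∘ A) F) n
    finiteSubfamily n =
      let F , C≤ = covered-≤ n (λ i → U i ∘ embed) (λ i → A i ∘ embed)
                     (λ i x → proj₁ (proj₂ (proj₂ (m i))) (embed x))
      -- Bounds on subsums concern duplicate-free lists only, so repetitions are removed from `F`.
      in deduplicate decide F , deduplicate-! decide F ,
         ≤-trans (C≤ (∈-deduplicate⁺ decide)) (≤-reflexive (sym (total-at (measure ∘ A) (deduplicate decide F) n)))

    approximate : ∀ t → UpperBound (measure ∘ A) t → ∀ n → ∃ λ k → 2^ k * mass ⋃A n ≤ at t (k + n) + 2^ k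
    approximate t ub n =
      -- The value `2 * 2^ n` for `a` makes the covering error `½ 2⁻ⁿ`. Comparing with `t` at index
      -- `suc (n + p)` costs at most another `½ 2⁻ⁿ`, which exhausts the slack allowed at `n`.
      let p , q        = mass-covered n (λ i → U i ∘ embed) ⋃A (λ i → open-embed (proj₁ (proj₂ (m i)))) remainder (2 * 2^ n)
          F , uq , C≤T = finiteSubfamily (n + p)
          k , r        = bound (ub (F , uq)) (suc (n + p))
      in suc (k + p) , ≲-combine (total (measure ∘ A) F) t n p k q C≤T r
      where
      remainder : Small (λ y → ⋃A y × ¬ ∃ λ i → U i (embed y))
      remainder = small-∘ {B = λ x → (∃ λ i → A i x) × ¬ ∃ λ i → U i x} embed-injective
        (small-⊆ (λ { x ((i , a) , ¬u) → i , a , λ u → ¬u (i , u) })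
        (small-⋃ I≼L λ i → proj₂ (proj₂ (proj₂ (m i)))))

  -- The cone meets the Cantor space within one cone of level `suc n`, of measure `2⁻ⁿ⁻¹`. The slack
  -- at index `suc n` is as large, so the `n`-th term of `t` is at most `2⁻ⁿ`.
  measure-cone : ∀ x n t → t ≲ measure (Cone x (enum (suc n))) → at t n ≤ 1
  measure-cone x n t p with bound p (suc n)
  ... | m , q = *-cancelˡ-≤ (2 * 2^ m) {{>-nonZero (≤-trans (1≤2^ m) (m≤m+n _ _))}} (begin
    2 * 2^ m * at t n                 ≡⟨ arrange (2^ m) (at t n) ⟩
    2^ m * (2 * at t n)               ≤⟨ *-monoʳ-≤ (2^ m) (doubling t n) ⟩
    2^ m * at t (suc n)               ≤⟨ q ⟩
    mass A (m + suc n) + 2^ m         ≡⟨ cong (λ i → mass A i + 2^ m) (+-comm m (suc n)) ⟩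
    mass A (suc n + m) + 2^ m         ≤⟨ +-monoˡ-≤ (2^ m) (mass-agree {A} (suc n) m (cone-agree (suc n))) ⟩
    2^ m + 2^ m                       ≡⟨ collect (2^ m) ⟩
    2 * 2^ m * 1                      ∎)
    where
    open ≤-Reasoning
    A = Cone x (enum (suc n)) ∘ embed

    arrange : ∀ a b → 2 * a * b ≡ a * (2 * b)
    arrange = solve-∀

    collect : ∀ a → a + a ≡ 2 * a * 1
    collect = solve-∀

  lebesgue : Measure measurable infinitarySum
  lebesgue = record
    { partialFunction = record
      { dom        = λ _ → Lift _ ⊤
      ; dom-resp   = λ _ p → p
      ; value      = λ {A} _ → measure A
      ; value-cong = λ {A} {B} (A⊆B , B⊆A) _ _ → measure-mono A B (λ _ → A⊆B) , measure-mono B A (λ _ → B⊆A)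
      }
    ; 𝔐⊆dom  = λ _ → lift tt
    ; μ-∅    = measure-small (λ _ → ⊥) (small-singleton λ _ _ ())
    ; μ-U    = pointwise⇒≲ (λ _ → z≤n) , λ (_ , p) → 1ᴰ≴0ᴰ (≲-trans (pointwise⇒≲ (mass-full {λ _ → ⊤} _)) p)
    ; μ-mono = λ {A} {B} _ _ A⊆B → measure-mono A B (λ _ → A⊆B)
    ; μ-⋃    = λ γ γ≼Λ A m disj →
        lift (_ , measure-⋃ A m (λ i j i≢j x a a′ → disj i j i≢j (a , a′)) γ≼Λ) , ≲-refl , ≲-refl
    ; μ-inf  = λ x m γ γ≼Λ A basis → record
      { lower    = λ i → measure-mono (x ≡_) (A i) λ { _ refl → IsOpenLocalBasis.centred basis i }
      -- Every cone at `x` contains a member of the basis, so `measure-cone` gives `at t n ≤ 1` for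
      -- all `n`, and this is exactly the slack with witness 0.
      ; greatest = λ t below → limit-≤ λ n →
          let i , A⊆cone = IsOpenLocalBasis.refines basis (cone-open x (enum (suc n))) (λ _ → refl)
              t≤1        = measure-cone x n t (≲-trans (below i) (measure-mono (A i) (Cone x (enum (suc n))) λ _ → A⊆cone))
          in 0 , ≤-trans (≤-reflexive (*-identityˡ _)) (≤-trans t≤1 (m≤n+m 1 _))
      }
    }

  continuous : Measure.IsContinuous lebesgue
  continuous x = singleton-measurable x , measure-small (x ≡_) (small-singleton λ _ _ p q → trans (sym p) q)

  -- The support and its weight.

  open Measure lebesgue using (supp; IsDirac)

  -- A neighbourhood of `embed y` contains the trace of a cone of some level `n`, so its mass is at
  -- least 2 at level `suc n`. Being null allows at most 1; level `n` itself would not suffice.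
  embed∈supp : ∀ y → supp (embed y)
  embed∈supp y (O , y∈O , o , (p , _)) with open-embed o y y∈O
  ... | n , sub = contradiction (begin
    2                         ≤⟨ *-monoʳ-≤ 2 (mass-nbhd {O ∘ embed} n y sub) ⟩
    2 * mass (O ∘ embed) n    ≤⟨ mass-doubling (O ∘ embed) n ⟩
    mass (O ∘ embed) (suc n)  ≤⟨ ≲0⇒≤1 p (suc n) ⟩
    1                         ∎) 1+n≰n
    where open ≤-Reasoning

  -- If some coordinate of `x` is not a bit, a cone fixing that coordinate misses the Cantor space
  -- and is an open null set around `x`.
  supp⊆embed : ∀ x → supp x → ∃ λ y → embed y ≡ x
  supp⊆embed x x∈supp = (λ n → proj₁ (binary (enum n))) , ext λ a →
    trans (sym (proj₂ (binary (enum (index a))))) (cong x (enum-index a))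
    where
    binary : ∀ a → ∃ λ b → x a ≡ bit b
    binary a with em {P = ∃ λ b → x a ≡ bit b}
    ... | yes r = r
    ... | no ¬r = contradiction
      -- The segment must reach beyond `a`, hence `suc`.
      ( Cone x (enum (suc (index a))) , (λ _ → refl) , cone-open x _
      , pointwise⇒≲ (mass-small {Cone x (enum (suc (index a))) ∘ embed}
          (small-singleton λ y _ y∈ → contradiction (_ , y∈ (a , a<)) ¬r))
      , pointwise⇒≲ λ _ → z≤n)
      x∈supp
      where
      a< : Lt κ a (enum (suc (index a)))
      a< = subst (λ b → Lt κ b (enum (suc (index a)))) (enum-index a) (enum-mono (n<1+n (index a)))

  -- Bijective binary numerals serve as finite binary words.
  size : ℕᵇ → ℕ
  size ℕᵇ.zero   = 0
  size 2[1+ w ]  = suc (size w)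
  size 1+[2 w ]  = suc (size w)

  -- Padding with `false` gives each word a point of its cone.
  extend : ℕᵇ → Cantor
  extend ℕᵇ.zero  = λ _ → false
  extend 2[1+ w ] = cons true (extend w)
  extend 1+[2 w ] = cons false (extend w)

  prefix : ∀ n (y : Cantor) → ∃ λ w → size w ≡ n × Agree n (extend w) y
  prefix zero    y = ℕᵇ.zero , refl , λ _ ()
  prefix (suc n) y with prefix n (y ∘ suc)
  ... | w , e , p = step (y 0) refl
    where
    agree : ∀ b → y 0 ≡ b → Agree (suc n) (cons b (extend w)) y
    agree b e zero    _         = sym e
    agree b e (suc k) (s≤s k<n) = p k k<n

    step : ∀ b → y 0 ≡ b → ∃ λ w → size w ≡ suc n × Agree (suc n) (extend w) y
    step true  e′ = 2[1+ w ] , cong suc e , agree true e′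
    step false e′ = 1+[2 w ] , cong suc e , agree false e′

  base : ℕ → 𝒫 X
  base i = Cone (embed (extend (fromℕ i))) (enum (size (fromℕ i)))

  base-isBase : IsBaseOf 𝒯 supp base
  base-isBase = record
    { isOpen  = λ i → cone-open _ _
    ; refines = λ o x∈supp x∈O → refine o (supp⊆embed _ x∈supp) x∈O
    }
    where
    refine : ∀ {O} → Open O → ∀ {x} → (∃ λ y → embed y ≡ x) → O x →
             ∃ λ i → base i x × (∀ {z} → base i z × supp z → O z)
    refine {O} o (y , refl) y∈O with open-embed o y y∈O
    ... | n , sub with prefix n y
    ... | w , refl , p = toℕ w , subst (λ w → WordCone w (embed y)) (sym (fromℕ-toℕ w)) (agree-cone (size w) p)
      , λ (z∈ , z∈supp) → inside (subst (λ w → WordCone w _) (fromℕ-toℕ w) z∈) (supp⊆embed _ z∈supp)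
      where
      WordCone : ℕᵇ → 𝒫 X
      WordCone w = Cone (embed (extend w)) (enum (size w))

      -- Points of the support come from the Cantor space, where lying in the cone means agreeing
      -- with `y` on the first `size w` bits.
      inside : ∀ {z} → WordCone w z → (∃ λ u → embed u ≡ z) → O z
      inside u∈ (u , refl) = sub u (cone-agree (size w) y u (agree-cone (size w) p) u∈)

  spike : ℕ → Cantor
  spike n k = n ≡ᵇ k

  -- The spikes form an infinite discrete set in the support: the cone of length `suc m` at spike
  -- `m` contains no other spike. Hence the base members chosen inside these cones are distinct.
  base-infinite : ∀ {I : Set} {B : I → 𝒫 X} → IsBaseOf 𝒯 supp B → ℕ ≼ I
  base-infinite {I} {B} isBase = mk↣ {to = λ n → proj₁ (near n)} λ {m} {n} e → spike-injective m n
    (cone-agree (suc m) (spike m) (spike n) (λ _ → refl)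
      (proj₂ (proj₂ (near m)) (subst (λ i → B i (embed (spike n))) (sym e) (proj₁ (proj₂ (near n))) , embed∈supp (spike n))))
    where
    near : ∀ n → ∃ λ i → B i (embed (spike n)) ×
                         (∀ {z} → B i z × supp z → Cone (embed (spike n)) (enum (suc n)) z)
    near n = IsBaseOf.refines isBase (cone-open (embed (spike n)) (enum (suc n))) (embed∈supp (spike n)) (λ _ → refl)

    spike-injective : ∀ m n → Agree (suc m) (spike m) (spike n) → m ≡ n
    spike-injective m n p = sym (≡ᵇ⇒≡ n m (subst Bool.T (p m ≤-refl) (≡⇒≡ᵇ m m refl)))

  dirac : IsDirac ω₁
  dirac = ω , record
    { isCardinal = ω-isCardinal
    ; attained   = base , base-isBase
    ; least      = base-infinite
    } , mk↣ id

proposition5p3 : (∀ {ℓ} → ExcludedMiddle ℓ) → (∀ {a b} → Extensionality a b) →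
    (κ Λ : Ordinal) → IsInfiniteCardinal κ → IsInfiniteCardinal Λ →
    Ordinal.Carrier κ ≼ Ordinal.Carrier Λ → IsRegular κ →
    (Λ ^< κ) ⤖ Ordinal.Carrier Λ →
    Ordinal.Carrier Λ ≺ (ℕ → Bool) →
    Σ PositivelyTotallyOrderedMonoid λ 𝕊 →
    Σ (InfinitarySum 𝕊) λ Sum →
    Σ (WeaklyMeasurable Λ (boundedTopology κ Λ)) λ ℳ →
    Σ (Measure ℳ Sum) λ μ →
    Measure.IsContinuous μ × Measure.IsDirac μ ω₁
proposition5p3 em ext κ Λ κ-infinite Λ-infinite _ _ Λ^<κ≅Λ (_ , 𝔠⋠Λ) =
  𝕊 , infinitarySum , measurable , lebesgue , continuous , dirac
  where
  open Construction em ext κ Λ (IsInfiniteCardinal.infinite κ-infinite) (IsInfiniteCardinal.infinite Λ-infinite)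
         (Bijection.injection Λ^<κ≅Λ) 𝔠⋠Λ
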